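{- Let $t \ge 2$ and $n \ge 3t-3$ be integers. Then $$\mathrm{wsat}(K_n,K_{t,t}) = (t-1)\left(n+1-\frac{t}{2}\right).$$
   Context: All graphs are finite and simple; $K_n$ is the complete graph on $n$ vertices and $K_{a,b}$ is the complete bipartite graph with parts of sizes $a$ and $b$. A copy of a graph $H$ in a graph $G$ is a (not necessarily induced) subgraph of $G$ isomorphic to $H$. Let $F$ and $H$ be graphs. A spanning subgraph $G$ of $F$ is weakly $(F,H)$-saturated if $G$ contains no copy of $H$, but there is an ordering $e_1,\ldots,e_k$ of $E(F)\setminus E(G)$ such that for each $i\in\{1,\dots,k\}$ the graph $G\cup\{e_1,\ldots,e_i\}$ contains a copy $H'$ of $H$ with $e_i\in E(H')$. The weak saturation number $\mathrm{wsat}(F,H)$ is the minimum number of edges of a weakly $(F,H)$-saturated graph. -}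

module Defs where

open import Data.Empty using (⊥)
open import Data.Fin using (Fin; toℕ; splitAt)
open import Data.Fin.Properties using (_≟_; _<?_)
open import Data.List using (List; length; take; lookup; filter; allFin; cartesianProduct)
open import Data.List.Membership.Propositional using (_∈_)
open import Data.List.Relation.Binary.Permutation.Propositional using (_↭_)
open import Data.Nat using (ℕ; suc; _+_; _≤_)
open import Data.Product using (_×_; _,_; Σ-syntax; ∃-syntax)
open import Data.Product.Properties using (≡-dec)
open import Data.Sum using (_⊎_; inj₁; inj₂)
open import Data.Unit using (⊤; tt)
open import Function using (_∘_)
open import Function.Definitions using (Injective)
open import Level using (0ℓ)
open import Relation.Binary using (Rel; Decidable; Symmetric; Irreflexive)
open import Relation.Binary.PropositionalEquality using (_≡_; _≢_; refl; sym)
open import Relation.Nullary using (¬_; yes; no; ¬?)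
open import Relation.Nullary.Decidable using (_×-dec_; _⊎-dec_)
import Data.List.Membership.DecPropositional as DecMembership

record Graph (n : ℕ) : Set₁ where
  field
    Adj        : Rel (Fin n) 0ℓ
    adj?       : Decidable Adj
    adj-sym    : Symmetric Adj
    adj-irrefl : Irreflexive _≡_ Adj

open Graph public

Pair : ℕ → Set
Pair n = Fin n × Fin n

-- Each edge is listed exactly once, as the pair (u , v) with u < v.
edges : ∀ {n} → Graph n → List (Pair n)
edges {n} G =
  filter (λ (u , v) → (u <? v) ×-dec adj? G u v)
         (cartesianProduct (allFin n) (allFin n))

size : ∀ {n} → Graph n → ℕ
size = length ∘ edges

missing : ∀ {n} → Graph n → Graph n → List (Pair n)
missing F G = filter (λ (u , v) → ¬? (adj? G u v)) (edges F)

complete : ∀ n → Graph n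
complete n = record
  { Adj        = _≢_
  ; adj?       = λ u v → ¬? (u ≟ v)
  ; adj-sym    = λ u≢v v≡u → u≢v (sym v≡u)
  ; adj-irrefl = λ u≡v u≢v → u≢v u≡v
  }

Opposite : ∀ {A B : Set} → Rel (A ⊎ B) 0ℓ
Opposite (inj₁ _) (inj₁ _) = ⊥
Opposite (inj₁ _) (inj₂ _) = ⊤
Opposite (inj₂ _) (inj₁ _) = ⊤
Opposite (inj₂ _) (inj₂ _) = ⊥

opposite? : ∀ {A B : Set} → Decidable (Opposite {A} {B})
opposite? (inj₁ _) (inj₁ _) = no λ ()
opposite? (inj₁ _) (inj₂ _) = yes tt
opposite? (inj₂ _) (inj₁ _) = yes tt
opposite? (inj₂ _) (inj₂ _) = no λ ()

opposite-sym : ∀ {A B : Set} → Symmetric (Opposite {A} {B})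
opposite-sym {x = inj₁ _} {inj₂ _} _ = tt
opposite-sym {x = inj₂ _} {inj₁ _} _ = tt

opposite-irrefl : ∀ {A B : Set} → Irreflexive _≡_ (Opposite {A} {B})
opposite-irrefl {x = inj₁ _} refl ()
opposite-irrefl {x = inj₂ _} refl ()

-- The parts are the first a and the last b vertices.
completeBipartite : ∀ a b → Graph (a + b)
completeBipartite a b = record
  { Adj        = λ u v → Opposite (splitAt a u) (splitAt a v)
  ; adj?       = λ u v → opposite? (splitAt a u) (splitAt a v)
  ; adj-sym    = λ {u} {v} → opposite-sym {x = splitAt a u} {splitAt a v}
  ; adj-irrefl = λ { {u} refl → opposite-irrefl {x = splitAt a u} refl }
  }

-- Pairs are read as unordered, and degenerate pairs (u , u) contribute nothing.
infixl 6 _∪_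
_∪_ : ∀ {n} → Graph n → List (Pair n) → Graph n
_∪_ {n} G es = record
  { Adj        = λ u v → Adj G u v ⊎ (u ≢ v × ((u , v) ∈ es ⊎ (v , u) ∈ es))
  ; adj?       = λ u v → adj? G u v ⊎-dec
                   (¬? (u ≟ v) ×-dec (((u , v) ∈? es) ⊎-dec ((v , u) ∈? es)))
  ; adj-sym    = λ { (inj₁ uv)              → inj₁ (adj-sym G uv)
                   ; (inj₂ (u≢v , inj₁ uv)) → inj₂ (u≢v ∘ sym , inj₂ uv)
                   ; (inj₂ (u≢v , inj₂ vu)) → inj₂ (u≢v ∘ sym , inj₁ vu) }
  ; adj-irrefl = λ { u≡v (inj₁ uv)        → adj-irrefl G u≡v uv
                   ; u≡v (inj₂ (u≢v , _)) → u≢v u≡v }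
  }
  where open DecMembership (≡-dec (_≟_ {n}) (_≟_ {n})) using (_∈?_)

infix 4 _⊆_
_⊆_ : ∀ {n} → Graph n → Graph n → Set
G ⊆ F = ∀ {u v} → Adj G u v → Adj F u v

-- The subgraph in question is the image of `vertex`: its edges are exactly
-- the images of the edges of H, so the subgraph need not be induced in G.
record Copy {m n} (H : Graph m) (G : Graph n) : Set where
  field
    vertex    : Fin m → Fin n
    injective : Injective _≡_ _≡_ vertex
    edge      : ∀ {a b} → Adj H a b → Adj G (vertex a) (vertex b)

infix 4 _∈ᴱ_
_∈ᴱ_ : ∀ {m n} {H : Graph m} {G : Graph n} → Pair n → Copy H G → Set
_∈ᴱ_ {H = H} (u , v) c =
  ∃[ a ] ∃[ b ] (Adj H a b × Copy.vertex c a ≡ u × Copy.vertex c b ≡ v)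

record WeaklySaturated {m n} (F : Graph n) (H : Graph m) (G : Graph n) : Set where
  field
    spanning : G ⊆ F
    free     : ¬ Copy H G
    order    : List (Pair n)
    ordering : order ↭ missing F G
    -- i counts from 0, so the first suc i edges include the one at position i.
    creates  : (i : Fin (length order)) →
               Σ[ c ∈ Copy H (G ∪ take (suc (toℕ i)) order) ] lookup order i ∈ᴱ c

-- IsWsat F H k says that wsat(F,H) exists and equals k.
record IsWsat {m n} (F : Graph n) (H : Graph m) (k : ℕ) : Set₁ where
  field
    attained : ∃[ G ] (WeaklySaturated F H G × size G ≡ k)
    minimal  : ∀ G → WeaklySaturated F H G → k ≤ size G

{-# OPTIONS --safe #-}
module Submission where

-- Put t = d + 1. Attach to each vertex u an integer polynomial β u of degree < d and to each edge
-- the number pairing β u v = (β u)(v) + (β v)(u). If the pairings vanish on all but one edge of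
-- a K_{t,t}, they vanish on the last one, because averaging over one side with weights that
-- annihilate polynomials of degree < d leaves a polynomial with d roots on the other side. Hence
-- a β vanishing on the edges of a weakly saturated G vanishes on all of K_n, so it comes from an
-- antisymmetric form in d variables: the n d coefficients of β are determined by e(G) equations
-- and d(d-1)/2 more, which gives e(G) ≥ n d - d(d-1)/2.
--
-- For the upper bound take d hubs forming an independent set, joined to all other vertices, and
-- a clique on d + 1 of these others. One adds the edges between the clique and the rest, then
-- those within the rest, and finally those between hubs; the last step needs 2d non-hubs, that is
-- n ≥ 3d. This graph is K_{t,t}-free because an edge of a copy would be redundant in the lower bound, which
-- its size attains.

import Algebra.Properties.Semiring.Sum
open import Data.Bool using (Bool; true; false; T)
open import Data.Bool.Properties using (T?)
open import Data.Fin as Fin using (Fin; zero; suc; toℕ; splitAt; join; _↑ˡ_; _↑ʳ_; punchIn; punchOut; inject≤; combine; remQuot)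
open import Data.Fin.Properties as Finᵖ using (any?; combine-remQuot; inject≤-injective; injective⇒≤; join-splitAt; punchIn-injective; punchIn-punchOut; punchInᵢ≢i; punchOut-injective; remQuot-combine; splitAt-↑ʳ; splitAt-↑ˡ; splitAt⁻¹-↑ʳ; splitAt⁻¹-↑ˡ; toℕ-injective; toℕ-↑ʳ; toℕ-↑ˡ; toℕ<n; ↑ʳ-injective; ↑ˡ-injective; <-cmp)
open import Data.Integer as ℤ using (ℤ; 0ℤ; 1ℤ)
open import Data.Integer using (+_)
import Data.Integer.Properties as ℤᵖ
import Data.Integer.Tactic.RingSolver as ℤSolver
open import Data.List using (List; []; _∷_; _++_; length; allFin; map; take; lookup; filter; cartesianProduct)
open import Data.List.Properties using (length-tabulate; length-++; length-map; take-suc; filter-notAll)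
open import Data.List.Membership.Propositional using (_∈_)
open import Data.List.Membership.Propositional.Properties using (∈-allFin; ∈-map⁺; ∈-++⁺ˡ; ∈-++⁺ʳ; ∈-++⁻; ∈-filter⁺; ∈-filter⁻; ∈-cartesianProduct⁺; ∈-lookup)
open import Data.List.Membership.Setoid.Properties using (index-injective)
open import Data.List.Relation.Binary.Permutation.Propositional using (_↭_; ↭-sym)
open import Data.List.Relation.Binary.Permutation.Propositional.Properties using (∈-resp-↭)
open import Data.List.Relation.Unary.All as All using ()
open import Data.List.Relation.Unary.AllPairs using (AllPairs; _∷_)
open import Data.List.Relation.Unary.Any as Any using (here; there; index)
open import Data.List.Relation.Unary.Any.Properties using (lookup-index)
open import Data.List.Relation.Unary.Sorted.TotalOrder.Properties using (Sorted⇒AllPairs)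
open import Data.List.Relation.Unary.Unique.Propositional using (Unique)
import Data.List.Relation.Unary.Unique.Propositional.Properties as Unique
import Data.List.Sort as Sort
open import Data.Nat as ℕ using (zero; suc; _+_; _<_; s≤s; z≤n)
open import Data.Nat using (ℕ; _*_; _∸_; _≤_)
import Data.Nat.Properties as ℕᵖ
import Data.Nat.Tactic.RingSolver as ℕSolver
open import Data.Product using (_×_; ∃-syntax)
open import Data.Product using (_,_; Σ-syntax; proj₁; proj₂)
open import Data.Product.Properties using (≡-dec)
open import Data.Rational using (1ℚ; _/_) renaming (_+_ to _+ℚ_; _-_ to _-ℚ_; _*_ to _*ℚ_)
open import Data.Rational using (toℚᵘ) renaming (-_ to -ℚ_)
import Data.Rational.Properties as ℚᵖ
open import Data.Rational.Unnormalised as ℚᵘ using (mkℚᵘ; *≡*; 1ℚᵘ)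
import Data.Rational.Unnormalised.Properties as ℚᵘᵖ
open import Data.Sum using (_⊎_; inj₁; inj₂; [_,_]′)
open import Data.Unit using (tt)
open import Data.Vec.Functional as Vector using (insertAt)
open import Data.Vec.Functional.Properties using (insertAt-lookup; insertAt-punchIn)
open import Function using (_∘_)
open import Function.Definitions using (Injective)
open import Relation.Binary using (DecTotalOrder; tri<; tri≈; tri>)
import Relation.Binary.Construct.On as On
open import Relation.Binary.PropositionalEquality using (_≡_)
open import Relation.Binary.PropositionalEquality using (_≢_; refl; sym; trans; cong; cong₂; subst; subst₂; setoid; module ≡-Reasoning)
open import Relation.Nullary using (¬_; yes; no; contradiction; ¬?)
open import Relation.Nullary.Decidable using (decidable-stable; _×-dec_)
open import Defs

open Algebra.Properties.Semiring.Sum ℤᵖ.+-*-semiring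
  using (sum; sum-cong-≗; sum-remove; sum-replicate-zero; ∑-distrib-+; ∑-comm; *-distribˡ-sum)

private variable
  d n t N M : ℕ
  X : Set
  x : X
  xs ys : List X

-- Integer linear algebra and polynomials

sum-zero : {g : Fin N → ℤ} → (∀ i → g i ≡ 0ℤ) → sum g ≡ 0ℤ
sum-zero {N} g≡0 = trans (sum-cong-≗ g≡0) (sum-replicate-zero N)

sum-single : (p : Fin N) (g : Fin N → ℤ) → (∀ i → i ≢ p → g i ≡ 0ℤ) → sum g ≡ g p
sum-single {suc N} p g g≡0 = begin
  sum g                               ≡⟨ sum-remove {i = p} g ⟩
  g p ℤ.+ sum (λ j → g (punchIn p j)) ≡⟨ cong (λ s → g p ℤ.+ s) (sum-zero λ j → g≡0 _ (punchInᵢ≢i p j)) ⟩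
  g p ℤ.+ 0ℤ                          ≡⟨ ℤᵖ.+-identityʳ (g p) ⟩
  g p                                 ∎
  where open ≡-Reasoning

-- Linearity is witnessed by a coefficient vector, because elimination has to search it for a
-- nonzero pivot.
Linear : ((Fin N → ℤ) → ℤ) → Set
Linear {N} ℓ = Σ[ r ∈ (Fin N → ℤ) ] (∀ c → ℓ c ≡ sum (λ q → r q ℤ.* c q))

linear-coordinate : (q : Fin N) → Linear (λ c → c q)
linear-coordinate {suc N} q = r , λ c → sym (begin
  sum (λ p → r p ℤ.* c p) ≡⟨ sum-single q _ (λ p p≢q → cong (ℤ._* c p) (r-off p p≢q)) ⟩
  r q ℤ.* c q             ≡⟨ cong (ℤ._* c q) (insertAt-lookup (λ _ → 0ℤ) q 1ℤ) ⟩
  1ℤ ℤ.* c q              ≡⟨ ℤᵖ.*-identityˡ (c q) ⟩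
  c q                     ∎)
  where
  open ≡-Reasoning
  r = insertAt (λ _ → 0ℤ) q 1ℤ
  r-off : ∀ p → p ≢ q → r p ≡ 0ℤ
  r-off p p≢q = subst (λ p → r p ≡ 0ℤ) (punchIn-punchOut (p≢q ∘ sym))
    (insertAt-punchIn (λ _ → 0ℤ) q 1ℤ (punchOut (p≢q ∘ sym)))

linear-0 : Linear {N} (λ _ → 0ℤ)
linear-0 {N} = (λ _ → 0ℤ) , λ c → sym (sum-zero {N} λ q → refl)

linear-+ : {ℓ ℓ′ : (Fin N → ℤ) → ℤ} → Linear ℓ → Linear ℓ′ → Linear (λ c → ℓ c ℤ.+ ℓ′ c)
linear-+ (r , ℓ≡) (r′ , ℓ′≡) = (λ q → r q ℤ.+ r′ q) , λ c →
  trans (cong₂ ℤ._+_ (ℓ≡ c) (ℓ′≡ c))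
    (trans (sym (∑-distrib-+ (λ q → r q ℤ.* c q) (λ q → r′ q ℤ.* c q)))
      (sum-cong-≗ λ q → sym (ℤᵖ.*-distribʳ-+ (c q) (r q) (r′ q))))

linear-*ˡ : {ℓ : (Fin N → ℤ) → ℤ} (a : ℤ) → Linear ℓ → Linear (λ c → a ℤ.* ℓ c)
linear-*ˡ a (r , ℓ≡) = (λ q → a ℤ.* r q) , λ c →
  trans (cong (a ℤ.*_) (ℓ≡ c))
    (trans (*-distribˡ-sum a (λ q → r q ℤ.* c q))
      (sum-cong-≗ λ q → sym (ℤᵖ.*-assoc a (r q) (c q))))

linear-sum : {F : Fin M → (Fin N → ℤ) → ℤ} → (∀ k → Linear (F k)) →
             Linear (λ c → sum (λ k → F k c))
linear-sum {zero}  F-lin = linear-0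
linear-sum {suc M} F-lin = linear-+ (F-lin zero) (linear-sum (F-lin ∘ suc))

linear-cong : {ℓ ℓ′ : (Fin N → ℤ) → ℤ} → (∀ c → ℓ′ c ≡ ℓ c) → Linear ℓ → Linear ℓ′
linear-cong ℓ′≡ℓ (r , ℓ≡) = r , λ c → trans (ℓ′≡ℓ c) (ℓ≡ c)

linear-∘ : {ℓ : (Fin M → ℤ) → ℤ} {T : (Fin N → ℤ) → Fin M → ℤ} →
           Linear ℓ → (∀ q → Linear (λ c → T c q)) → Linear (ℓ ∘ T)
linear-∘ {T = T} (r , ℓ≡) T-lin =
  linear-cong (ℓ≡ ∘ T) (linear-sum λ q → linear-*ˡ (r q) (T-lin q))

*-nonzero : ∀ {a b} → a ≢ 0ℤ → b ≢ 0ℤ → a ℤ.* b ≢ 0ℤ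
*-nonzero {a} a≢0 b≢0 ab≡0 = [ a≢0 , b≢0 ]′ (ℤᵖ.i*j≡0⇒i≡0∨j≡0 a ab≡0)

*-cancel-zero : ∀ {a b} → a ≢ 0ℤ → a ℤ.* b ≡ 0ℤ → b ≡ 0ℤ
*-cancel-zero {a} a≢0 ab≡0 with ℤᵖ.i*j≡0⇒i≡0∨j≡0 a ab≡0
... | inj₁ a≡0 = contradiction a≡0 a≢0
... | inj₂ b≡0 = b≡0

-- Fraction-free elimination: solutions of r · c = 0 with r p ≢ 0 are parametrised
-- by the coordinates other than p, scaled by r p.
module _ (r : Fin (suc N) → ℤ) (p : Fin (suc N)) where
  eliminate : (Fin N → ℤ) → Fin (suc N) → ℤ
  eliminate c = insertAt (λ j → r p ℤ.* c j) p (ℤ.- sum (λ j → r (punchIn p j) ℤ.* c j))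

  eliminate-punchIn : ∀ c j → eliminate c (punchIn p j) ≡ r p ℤ.* c j
  eliminate-punchIn c = insertAt-punchIn (λ j → r p ℤ.* c j) p _

  eliminate-pivot : ∀ c → eliminate c p ≡ ℤ.- sum (λ j → r (punchIn p j) ℤ.* c j)
  eliminate-pivot c = insertAt-lookup (λ j → r p ℤ.* c j) p _

  eliminate-linear : ∀ q → Linear (λ c → eliminate c q)
  eliminate-linear q with p Fin.≟ q
  ... | yes refl = linear-cong
    (λ c → trans (eliminate-pivot c) (sym (ℤᵖ.-1*i≡-i _)))
    (linear-*ˡ ℤ.-1ℤ (linear-sum λ j → linear-*ˡ (r (punchIn p j)) (linear-coordinate j)))
  ... | no p≢q = subst (λ q → Linear (λ c → eliminate c q)) (punchIn-punchOut p≢q)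
    (linear-cong (λ c → eliminate-punchIn c (punchOut p≢q))
      (linear-*ˡ (r p) (linear-coordinate (punchOut p≢q))))

  eliminate-solves : ∀ c → sum (λ q → r q ℤ.* eliminate c q) ≡ 0ℤ
  eliminate-solves c = begin
    sum (λ q → r q ℤ.* eliminate c q)
      ≡⟨ sum-remove {i = p} (λ q → r q ℤ.* eliminate c q) ⟩
    r p ℤ.* eliminate c p ℤ.+ sum (λ j → r (punchIn p j) ℤ.* eliminate c (punchIn p j))
      ≡⟨ cong₂ ℤ._+_ (cong (r p ℤ.*_) (eliminate-pivot c))
           (sum-cong-≗ λ j → trans (cong (r (punchIn p j) ℤ.*_) (eliminate-punchIn c j))
                                    (swap (r (punchIn p j)) (r p) (c j))) ⟩
    r p ℤ.* (ℤ.- s) ℤ.+ sum (λ j → r p ℤ.* (r (punchIn p j) ℤ.* c j))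
      ≡⟨ cong (λ z → r p ℤ.* (ℤ.- s) ℤ.+ z) (sym (*-distribˡ-sum (r p) (λ j → r (punchIn p j) ℤ.* c j))) ⟩
    r p ℤ.* (ℤ.- s) ℤ.+ r p ℤ.* s
      ≡⟨ cancel (r p) s ⟩
    0ℤ ∎
    where
    open ≡-Reasoning
    s = sum (λ j → r (punchIn p j) ℤ.* c j)
    swap : ∀ x y z → x ℤ.* (y ℤ.* z) ≡ y ℤ.* (x ℤ.* z)
    swap = ℤSolver.solve-∀
    cancel : ∀ x y → x ℤ.* (ℤ.- y) ℤ.+ x ℤ.* y ≡ 0ℤ
    cancel = ℤSolver.solve-∀

Nonzero : (Fin N → ℤ) → Set
Nonzero c = ∃[ q ] c q ≢ 0ℤ

-- Induction on the equations. One with a nonzero coefficient costs one variable: the others are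
-- pulled back along `eliminate`, and scaling by the pivot keeps a nonzero coordinate nonzero. An
-- equation whose coefficients are all zero is dropped.
nontrivial-solution : {A : Set} (xs : List A) {ℓ : A → (Fin N → ℤ) → ℤ} →
  (∀ a → Linear (ℓ a)) → length xs < N →
  Σ[ c ∈ (Fin N → ℤ) ] (Nonzero c × (∀ {a} → a ∈ xs → ℓ a c ≡ 0ℤ))
nontrivial-solution {suc N} [] ℓ-lin _ = (λ _ → 1ℤ) , (zero , λ ()) , λ ()
nontrivial-solution {suc N} (x ∷ xs) {ℓ} ℓ-lin (s≤s |xs|<N)
  with ℓ-lin x
... | r , ℓ≡ with any? (λ p → ¬? (r p ℤ.≟ 0ℤ))
... | yes (p , rp≢0) with nontrivial-solution xs (λ a → linear-∘ (ℓ-lin a) (eliminate-linear r p)) |xs|<N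
... | c , (q , cq≢0) , solves = eliminate r p c
  , (punchIn p q , λ e≡0 → *-nonzero rp≢0 cq≢0 (trans (sym (eliminate-punchIn r p c q)) e≡0))
  , λ { (here refl) → trans (ℓ≡ _) (eliminate-solves r p c)
      ; (there a∈xs) → solves a∈xs }
nontrivial-solution {suc N} (x ∷ xs) {ℓ} ℓ-lin (s≤s |xs|<N)
    | r , ℓ≡ | no r≡0 with nontrivial-solution xs ℓ-lin (ℕᵖ.m≤n⇒m≤1+n |xs|<N)
... | c , c≢0 , solves = c , c≢0 , λ
  { (here refl) → trans (ℓ≡ c) (sum-zero λ q →
      cong (ℤ._* c q) (decidable-stable (r q ℤ.≟ 0ℤ) λ rq≢0 → r≡0 (q , rq≢0)))
  ; (there a∈xs) → solves a∈xs }

opaque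
  eval : (Fin N → ℤ) → ℤ → ℤ
  eval c x = sum (λ k → c k ℤ.* x ℤ.^ toℕ k)

  eval-monomials : (c : Fin N → ℤ) (x : ℤ) → eval c x ≡ sum (λ k → c k ℤ.* x ℤ.^ toℕ k)
  eval-monomials c x = refl

  eval-zero : {c : Fin N → ℤ} → (∀ k → c k ≡ 0ℤ) → ∀ x → eval c x ≡ 0ℤ
  eval-zero c≡0 x = sum-zero λ k → cong (ℤ._* x ℤ.^ toℕ k) (c≡0 k)

  eval-horner : (c : Fin (suc N) → ℤ) (x : ℤ) → eval c x ≡ c zero ℤ.+ x ℤ.* eval (c ∘ suc) x
  eval-horner c x = cong₂ ℤ._+_ (ℤᵖ.*-identityʳ (c zero))
    (trans (sum-cong-≗ λ k → shift (c (suc k)) x (x ℤ.^ toℕ k))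
      (sym (*-distribˡ-sum x λ k → c (suc k) ℤ.* x ℤ.^ toℕ k)))
    where
    shift : ∀ a b e → a ℤ.* (b ℤ.* e) ≡ b ℤ.* (a ℤ.* e)
    shift = ℤSolver.solve-∀

  eval-linear : {F : (Fin M → ℤ) → Fin N → ℤ} → (∀ k → Linear (λ c → F c k)) →
                ∀ x → Linear (λ c → eval (F c) x)
  eval-linear {F = F} F-lin x = linear-sum λ k →
    linear-cong (λ c → ℤᵖ.*-comm (F c k) (x ℤ.^ toℕ k)) (linear-*ˡ (x ℤ.^ toℕ k) (F-lin k))

  eval-∑ : (w : Fin M → ℤ) (c : Fin M → Fin N → ℤ) (x : ℤ) →
           eval (λ k → sum (λ i → w i ℤ.* c i k)) x ≡ sum (λ i → w i ℤ.* eval (c i) x)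
  eval-∑ w c x = begin
    sum (λ k → sum (λ i → w i ℤ.* c i k) ℤ.* x ℤ.^ toℕ k)
      ≡⟨ sum-cong-≗ (λ k → trans (ℤᵖ.*-comm (sum (λ i → w i ℤ.* c i k)) (x ℤ.^ toℕ k))
           (trans (*-distribˡ-sum (x ℤ.^ toℕ k) (λ i → w i ℤ.* c i k))
             (sum-cong-≗ λ i → shift (x ℤ.^ toℕ k) (w i) (c i k)))) ⟩
    sum (λ k → sum (λ i → w i ℤ.* (c i k ℤ.* x ℤ.^ toℕ k)))
      ≡⟨ ∑-comm (λ k i → w i ℤ.* (c i k ℤ.* x ℤ.^ toℕ k)) ⟩
    sum (λ i → sum (λ k → w i ℤ.* (c i k ℤ.* x ℤ.^ toℕ k)))
      ≡⟨ sum-cong-≗ (λ i → sym (*-distribˡ-sum (w i) (λ k → c i k ℤ.* x ℤ.^ toℕ k))) ⟩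
    sum (λ i → w i ℤ.* eval (c i) x) ∎
    where
    open ≡-Reasoning
    shift : ∀ a b e → a ℤ.* (b ℤ.* e) ≡ b ℤ.* (e ℤ.* a)
    shift = ℤSolver.solve-∀

-- Synthetic division by X − a.
divide : ℤ → (Fin (suc N) → ℤ) → Fin N → ℤ
divide {suc N} a c zero    = eval (c ∘ suc) a
divide {suc N} a c (suc k) = divide a (c ∘ suc) k

-- Induction by Horner's scheme: `c` is its constant term plus X times `c ∘ suc`, and its quotient
-- is the value of `c ∘ suc` at `a` plus X times the quotient of `c ∘ suc`.
divide-eval : ∀ a (c : Fin (suc N) → ℤ) x →
              eval c x ≡ eval c a ℤ.+ (x ℤ.- a) ℤ.* eval (divide a c) x
divide-eval {zero} a c x = begin
  eval c x
    ≡⟨ constant x ⟩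
  c zero
    ≡⟨ pad (c zero) (x ℤ.- a) ⟩
  c zero ℤ.+ (x ℤ.- a) ℤ.* 0ℤ
    ≡⟨ cong₂ (λ y z → y ℤ.+ (x ℤ.- a) ℤ.* z) (sym (constant a)) (sym (eval-zero (λ ()) x)) ⟩
  eval c a ℤ.+ (x ℤ.- a) ℤ.* eval (divide a c) x ∎
  where
  open ≡-Reasoning
  pad : ∀ u v → u ≡ u ℤ.+ v ℤ.* 0ℤ
  pad = ℤSolver.solve-∀

  constant : ∀ y → eval c y ≡ c zero
  constant y = trans (eval-horner c y)
    (trans (cong (λ z → c zero ℤ.+ y ℤ.* z) (eval-zero (λ ()) y)) (sym (pad (c zero) y)))
divide-eval {suc N} a c x = begin
  eval c x
    ≡⟨ eval-horner c x ⟩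
  c zero ℤ.+ x ℤ.* eval (c ∘ suc) x
    ≡⟨ cong (λ z → c zero ℤ.+ x ℤ.* z) (divide-eval a (c ∘ suc) x) ⟩
  c zero ℤ.+ x ℤ.* (eval (c ∘ suc) a ℤ.+ (x ℤ.- a) ℤ.* eval (divide a (c ∘ suc)) x)
    ≡⟨ regroup (c zero) x a (eval (c ∘ suc) a) (eval (divide a (c ∘ suc)) x) ⟩
  (c zero ℤ.+ a ℤ.* eval (c ∘ suc) a)
    ℤ.+ (x ℤ.- a) ℤ.* (eval (c ∘ suc) a ℤ.+ x ℤ.* eval (divide a (c ∘ suc)) x)
    ≡⟨ cong₂ (λ y z → y ℤ.+ (x ℤ.- a) ℤ.* z) (sym (eval-horner c a)) (sym (eval-horner (divide a c) x)) ⟩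
  eval c a ℤ.+ (x ℤ.- a) ℤ.* eval (divide a c) x ∎
  where
  open ≡-Reasoning
  regroup : ∀ c₀ x a e q → c₀ ℤ.+ x ℤ.* (e ℤ.+ (x ℤ.- a) ℤ.* q)
                          ≡ (c₀ ℤ.+ a ℤ.* e) ℤ.+ (x ℤ.- a) ℤ.* (e ℤ.+ x ℤ.* q)
  regroup = ℤSolver.solve-∀

-- The constant coefficient of the quotient is the value of `c ∘ suc` at `a`, and the remaining ones
-- form the quotient of `c ∘ suc`, so by recursion the tail of `c` is zero. Horner's scheme at `a`
-- then gives `c zero`.
divide-zero : ∀ a (c : Fin (suc N) → ℤ) → eval c a ≡ 0ℤ → (∀ k → divide a c k ≡ 0ℤ) → ∀ k → c k ≡ 0ℤ
divide-zero {N} a c ca≡0 q≡0 = λ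
  { zero → begin
      c zero                            ≡⟨ drop (c zero) a ⟩
      c zero ℤ.+ a ℤ.* 0ℤ               ≡⟨ cong (λ z → c zero ℤ.+ a ℤ.* z) (sym (tail-a N c q≡0)) ⟩
      c zero ℤ.+ a ℤ.* eval (c ∘ suc) a ≡⟨ sym (eval-horner c a) ⟩
      eval c a                          ≡⟨ ca≡0 ⟩
      0ℤ                                ∎
  ; (suc k) → tail-zero N c q≡0 k }
  where
  open ≡-Reasoning
  drop : ∀ x y → x ≡ x ℤ.+ y ℤ.* 0ℤ
  drop = ℤSolver.solve-∀
  tail-a : ∀ N (c : Fin (suc N) → ℤ) → (∀ k → divide a c k ≡ 0ℤ) → eval (c ∘ suc) a ≡ 0ℤ
  tail-a zero    c q≡0 = eval-zero (λ ()) a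
  tail-a (suc N) c q≡0 = q≡0 zero
  tail-zero : ∀ N (c : Fin (suc N) → ℤ) → (∀ k → divide a c k ≡ 0ℤ) → ∀ k → c (suc k) ≡ 0ℤ
  tail-zero (suc N) c q≡0 = divide-zero a (c ∘ suc) (q≡0 zero) (q≡0 ∘ suc)

-- The quotient by X minus the first root vanishes at the other roots, since these differ from the
-- first and ℤ has no zero divisors.
roots⇒zero : (c : Fin N → ℤ) (z : Fin N → ℤ) → Injective _≡_ _≡_ z →
             (∀ i → eval c (z i) ≡ 0ℤ) → ∀ k → c k ≡ 0ℤ
roots⇒zero {suc N} c z z-inj root = divide-zero (z zero) c (root zero)
  (roots⇒zero (divide (z zero) c) (z ∘ suc) (Finᵖ.suc-injective ∘ z-inj) λ i →
    *-cancel-zero (λ e → Finᵖ.0≢1+n (sym (z-inj (ℤᵖ.i-j≡0⇒i≡j (z (suc i)) (z zero) e))))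
      (trans (sym (ℤᵖ.+-identityˡ _))
        (trans (cong (ℤ._+ (z (suc i) ℤ.- z zero) ℤ.* eval (divide (z zero) c) (z (suc i))) (sym (root zero)))
          (trans (sym (divide-eval (z zero) c (z (suc i)))) (root (suc i))))))

-- If w p vanished while w q did not, a nonzero polynomial vanishing at the points other than
-- p and q would have to vanish at q as well, and so have too many roots.
dependency-support : (z w : Fin (suc N) → ℤ) → Injective _≡_ _≡_ z →
  (∀ (c : Fin N → ℤ) → sum (λ i → w i ℤ.* eval c (z i)) ≡ 0ℤ) →
  ∀ p q → w q ≢ 0ℤ → w p ≢ 0ℤ
dependency-support {zero} z w z-inj ann zero zero wq≢0 wp≡0 = wq≢0 wp≡0
dependency-support {suc N} z w z-inj ann p q wq≢0 wp≡0 =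
  c-nonzero (roots⇒zero c (z ∘ punchIn p) (punchIn-injective p _ _ ∘ z-inj) root)
  where
  p≢q : p ≢ q
  p≢q refl = wq≢0 wp≡0

  q′ : Fin (suc N)
  q′ = punchOut p≢q

  -- `N` conditions on `suc N` coefficients: `punchIn p (punchIn q′ j)` runs through the indices
  -- other than `p` and `q`.
  vanishing : Σ[ c ∈ (Fin (suc N) → ℤ) ] (Nonzero c ×
    (∀ {j} → j ∈ allFin N → eval c (z (punchIn p (punchIn q′ j))) ≡ 0ℤ))
  vanishing = nontrivial-solution (allFin N) {λ j c → eval c (z (punchIn p (punchIn q′ j)))}
    (λ j → eval-linear {F = λ c → c} linear-coordinate (z (punchIn p (punchIn q′ j))))
    (s≤s (ℕᵖ.≤-reflexive (length-tabulate {n = N} (λ i → i))))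

  c : Fin (suc N) → ℤ
  c = proj₁ vanishing

  c-nonzero : ¬ (∀ k → c k ≡ 0ℤ)
  c-nonzero c≡0 = let (k , ck≢0) , _ = proj₂ vanishing in ck≢0 (c≡0 k)

  off : ∀ j → j ≢ q′ → eval c (z (punchIn p j)) ≡ 0ℤ
  off j j≢q′ = subst (λ j → eval c (z (punchIn p j)) ≡ 0ℤ) (punchIn-punchOut (j≢q′ ∘ sym))
    (proj₂ (proj₂ vanishing) (∈-allFin (punchOut (j≢q′ ∘ sym))))

  other : ∀ i → i ≢ q → w i ℤ.* eval c (z i) ≡ 0ℤ
  other i i≢q with p Fin.≟ i
  ... | yes refl = cong (ℤ._* eval c (z i)) wp≡0
  ... | no p≢i = trans (cong (w i ℤ.*_)
      (subst (λ i → eval c (z i) ≡ 0ℤ) (punchIn-punchOut p≢i)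
        (off (punchOut p≢i) (i≢q ∘ punchOut-injective p≢i p≢q))))
      (ℤᵖ.*-zeroʳ (w i))

  -- In the annihilated sum the term at `p` vanishes because `w p` does, and every other term except
  -- that at `q` because `c` has a root there.
  at-q : eval c (z q) ≡ 0ℤ
  at-q = *-cancel-zero wq≢0 (trans (sym (sum-single q _ other)) (ann c))

  root : ∀ j → eval c (z (punchIn p j)) ≡ 0ℤ
  root j with j Fin.≟ q′
  ... | yes refl = subst (λ i → eval c (z i) ≡ 0ℤ) (sym (punchIn-punchOut p≢q)) at-q
  ... | no j≢q′ = off j j≢q′

-- `N` moment equations in `suc N` weights have a nonzero solution, and `dependency-support` shows
-- that all its weights are then nonzero. Up to a scalar these are the weights of a divided
-- difference.
annihilator : (z : Fin (suc N) → ℤ) → Injective _≡_ _≡_ z →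
  Σ[ w ∈ (Fin (suc N) → ℤ) ] ((∀ i → w i ≢ 0ℤ) ×
    (∀ (c : Fin N → ℤ) → sum (λ i → w i ℤ.* eval c (z i)) ≡ 0ℤ))
annihilator {N} z z-inj
  with nontrivial-solution (allFin N) {λ k w → sum (λ i → z i ℤ.^ toℕ k ℤ.* w i)}
         (λ k → (λ i → z i ℤ.^ toℕ k) , λ _ → refl)
         (s≤s (ℕᵖ.≤-reflexive (length-tabulate {n = N} (λ i → i))))
... | w , (q , wq≢0) , solves =
  w , (λ p → dependency-support z w z-inj annihilates p q wq≢0) , annihilates
  where
  open ≡-Reasoning
  swap : ∀ x y e → x ℤ.* (y ℤ.* e) ≡ y ℤ.* (e ℤ.* x)
  swap = ℤSolver.solve-∀

  annihilates : ∀ (c : Fin N → ℤ) → sum (λ i → w i ℤ.* eval c (z i)) ≡ 0ℤ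
  annihilates c = begin
    sum (λ i → w i ℤ.* eval c (z i))
      ≡⟨ sum-cong-≗ (λ i → trans (cong (w i ℤ.*_) (eval-monomials c (z i)))
           (*-distribˡ-sum (w i) (λ k → c k ℤ.* z i ℤ.^ toℕ k))) ⟩
    sum (λ i → sum (λ k → w i ℤ.* (c k ℤ.* z i ℤ.^ toℕ k)))
      ≡⟨ ∑-comm (λ i k → w i ℤ.* (c k ℤ.* z i ℤ.^ toℕ k)) ⟩
    sum (λ k → sum (λ i → w i ℤ.* (c k ℤ.* z i ℤ.^ toℕ k)))
      ≡⟨ sum-zero (λ k → trans
           (sum-cong-≗ λ i → swap (w i) (c k) (z i ℤ.^ toℕ k))
           (trans (sym (*-distribˡ-sum (c k) (λ i → z i ℤ.^ toℕ k ℤ.* w i)))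
             (trans (cong (c k ℤ.*_) (solves (∈-allFin k))) (ℤᵖ.*-zeroʳ (c k))))) ⟩
    0ℤ ∎

-- The lower bound

pairs : ∀ n → List (Pair n)
pairs zero    = []
pairs (suc n) = map (λ j → zero , suc j) (allFin n) ++ map (λ (i , j) → suc i , suc j) (pairs n)

-- The binomial coefficient of `n` over 2, kept as a list length because it counts both equations
-- and clique edges.
triangle : ℕ → ℕ
triangle n = length (pairs n)

triangle-suc : ∀ n → triangle (suc n) ≡ n + triangle n
triangle-suc n = trans (length-++ (map (λ j → zero , suc j) (allFin n)))
  (cong₂ ℕ._+_ (trans (length-map (λ j → zero , suc j) (allFin n)) (length-tabulate (λ j → j)))
               (length-map (λ (i , j) → suc i , suc j) (pairs n)))

∈-pairs : {i j : Fin n} → i Fin.< j → (i , j) ∈ pairs n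
∈-pairs {i = zero}  {suc j} _         = ∈-++⁺ˡ (∈-map⁺ (λ j → zero , suc j) (∈-allFin j))
∈-pairs {i = suc i} {suc j} (s≤s i<j) =
  ∈-++⁺ʳ (map (λ j → zero , suc j) (allFin _)) (∈-map⁺ (λ (i , j) → suc i , suc j) (∈-pairs i<j))

x+x≡0⇒x≡0 : ∀ x → x ℤ.+ x ≡ 0ℤ → x ≡ 0ℤ
x+x≡0⇒x≡0 x x+x≡0 = *-cancel-zero {+ 2} (λ ()) (trans (double x) x+x≡0)
  where
  double : ∀ x → + 2 ℤ.* x ≡ x ℤ.+ x
  double = ℤSolver.solve-∀

point : Fin n → ℤ
point u = + toℕ u

point-injective : Injective _≡_ _≡_ (point {n})
point-injective = toℕ-injective ∘ ℤᵖ.+-injective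

pairing : (Fin n → Fin d → ℤ) → Fin n → Fin n → ℤ
pairing β u v = eval (β u) (point v) ℤ.+ eval (β v) (point u)

pairing-sym : (β : Fin n → Fin d → ℤ) (u v : Fin n) → pairing β u v ≡ pairing β v u
pairing-sym β u v = ℤᵖ.+-comm (eval (β u) (point v)) (eval (β v) (point u))

-- Averaging over P with annihilating weights turns v ↦ pairing β (P i) v into the values at
-- point v of one polynomial of degree < d, which vanishes at the d vertices Q j with j ≢ b.
exchange : (β : Fin n → Fin d → ℤ) (P Q : Fin (suc d) → Fin n) →
  Injective _≡_ _≡_ P → Injective _≡_ _≡_ Q → ∀ a b →
  (∀ i j → i ≢ a ⊎ j ≢ b → pairing β (P i) (Q j) ≡ 0ℤ) → pairing β (P a) (Q b) ≡ 0ℤ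
exchange {d = d} β P Q P-inj Q-inj a b vanish
  with annihilator (point ∘ P) (P-inj ∘ point-injective)
... | w , w≢0 , ann = *-cancel-zero (w≢0 a) (begin
    w a ℤ.* pairing β (P a) (Q b)
      ≡⟨ sym (sum-single a _ λ i i≢a → trans (cong (w i ℤ.*_) (vanish i b (inj₁ i≢a))) (ℤᵖ.*-zeroʳ (w i))) ⟩
    average b
      ≡⟨ average-eval b ⟩
    eval γ (point (Q b))
      ≡⟨ eval-zero γ≡0 (point (Q b)) ⟩
    0ℤ ∎)
  where
  open ≡-Reasoning
  γ : Fin d → ℤ
  γ k = sum (λ i → w i ℤ.* β (P i) k)

  average : Fin (suc d) → ℤ
  average j = sum (λ i → w i ℤ.* pairing β (P i) (Q j))

  average-eval : ∀ j → average j ≡ eval γ (point (Q j))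
  average-eval j = begin
    average j
      ≡⟨ sum-cong-≗ (λ i → ℤᵖ.*-distribˡ-+ (w i) (eval (β (P i)) (point (Q j))) (eval (β (Q j)) (point (P i)))) ⟩
    sum (λ i → w i ℤ.* eval (β (P i)) (point (Q j)) ℤ.+ w i ℤ.* eval (β (Q j)) (point (P i)))
      ≡⟨ ∑-distrib-+ (λ i → w i ℤ.* eval (β (P i)) (point (Q j))) (λ i → w i ℤ.* eval (β (Q j)) (point (P i))) ⟩
    sum (λ i → w i ℤ.* eval (β (P i)) (point (Q j))) ℤ.+ sum (λ i → w i ℤ.* eval (β (Q j)) (point (P i)))
      -- The second sum evaluates the fixed polynomial `β (Q j)` at the points of `P`, so the
      -- weights annihilate it.
      ≡⟨ cong₂ ℤ._+_ (sym (eval-∑ w (β ∘ P) (point (Q j)))) (ann (β (Q j))) ⟩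
    eval γ (point (Q j)) ℤ.+ 0ℤ
      ≡⟨ ℤᵖ.+-identityʳ _ ⟩
    eval γ (point (Q j)) ∎

  γ≡0 : ∀ k → γ k ≡ 0ℤ
  γ≡0 = roots⇒zero γ (point ∘ Q ∘ punchIn b) (punchIn-injective b _ _ ∘ Q-inj ∘ point-injective) λ j →
    trans (sym (average-eval (punchIn b j))) (sum-zero λ i →
      trans (cong (w i ℤ.*_) (vanish i (punchIn b j) (inj₂ (punchInᵢ≢i b j)))) (ℤᵖ.*-zeroʳ (w i)))

↑ˡ≢↑ʳ : ∀ {m n} (i : Fin m) (j : Fin n) → i ↑ˡ n ≢ m ↑ʳ j
↑ˡ≢↑ʳ {m} {n} i j i≡j
  with () ← trans (sym (splitAt-↑ˡ m i n)) (trans (cong (Fin.splitAt m) i≡j) (splitAt-↑ʳ m n j))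

-- Two sets of d + 1 vertices that meet in u only.
pairing-diagonal : (β : Fin n → Fin d → ℤ) → d + d < n →
  (∀ u v → u ≢ v → pairing β u v ≡ 0ℤ) → ∀ u → pairing β u u ≡ 0ℤ
pairing-diagonal {suc n} {d} β (s≤s 2d≤n) vanish u =
  exchange β P Q P-inj Q-inj zero zero λ i j → vanish (P i) (Q j) ∘ disjoint i j
  where
  others : Fin (d + d) → Fin (suc n)
  others k = punchIn u (inject≤ k 2d≤n)

  others-injective : ∀ {i j} → others i ≡ others j → i ≡ j
  others-injective {i} {j} = inject≤-injective 2d≤n 2d≤n i j ∘ punchIn-injective u _ _

  others≢u : ∀ k → others k ≢ u
  others≢u k = punchInᵢ≢i u (inject≤ k 2d≤n)

  P Q : Fin (suc d) → Fin (suc n)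
  P zero    = u
  P (suc i) = others (i ↑ˡ d)
  Q zero    = u
  Q (suc j) = others (d ↑ʳ j)

  P-inj : Injective _≡_ _≡_ P
  P-inj {zero}  {zero}  _  = refl
  P-inj {zero}  {suc j} eq = contradiction (sym eq) (others≢u _)
  P-inj {suc i} {zero}  eq = contradiction eq (others≢u _)
  P-inj {suc i} {suc j} eq = cong suc (↑ˡ-injective d i j (others-injective eq))

  Q-inj : Injective _≡_ _≡_ Q
  Q-inj {zero}  {zero}  _  = refl
  Q-inj {zero}  {suc j} eq = contradiction (sym eq) (others≢u _)
  Q-inj {suc i} {zero}  eq = contradiction eq (others≢u _)
  Q-inj {suc i} {suc j} eq = cong suc (↑ʳ-injective d i j (others-injective eq))

  disjoint : ∀ i j → i ≢ zero ⊎ j ≢ zero → P i ≢ Q j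
  disjoint zero    zero    (inj₁ 0≢0) _  = 0≢0 refl
  disjoint zero    zero    (inj₂ 0≢0) _  = 0≢0 refl
  disjoint zero    (suc j) _          eq = others≢u _ (sym eq)
  disjoint (suc i) zero    _          eq = others≢u _ eq
  disjoint (suc i) (suc j) _          eq = ↑ˡ≢↑ʳ i j (others-injective eq)

-- The β with all pairings zero correspond to the antisymmetric forms β u = Q(point u , –);
-- the extra equations, indexed by pairs d, single out Q = 0.
gauge-fixed⇒zero : (β : Fin n → Fin d → ℤ) (d≤n : d ≤ n) → (∀ u v → pairing β u v ≡ 0ℤ) →
  (∀ {i j} → (i , j) ∈ pairs d → eval (β (inject≤ i d≤n)) (point (inject≤ j d≤n)) ≡ 0ℤ) →
  ∀ u k → β u k ≡ 0ℤ
-- First the polynomials at the base vertices `ι i` vanish, having the `d` base points as roots.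
-- Then `flip` turns the vanishing of `β (ι j)` into the root `point (ι j)` of any `β u`.
gauge-fixed⇒zero {n} {d} β d≤n vanish gauge = λ u → vanishes-on-base u λ j →
  flip (ι j) u (eval-zero (vanishes-on-base (ι j) (base j)) (point u))
  where
  ι : Fin d → Fin n
  ι i = inject≤ i d≤n

  flip : ∀ u v → eval (β u) (point v) ≡ 0ℤ → eval (β v) (point u) ≡ 0ℤ
  flip u v e≡0 = trans (sym (ℤᵖ.+-identityˡ _))
    (trans (cong (ℤ._+ eval (β v) (point u)) (sym e≡0)) (vanish u v))

  vanishes-on-base : ∀ u → (∀ j → eval (β u) (point (ι j)) ≡ 0ℤ) → ∀ k → β u k ≡ 0ℤ
  vanishes-on-base u = roots⇒zero (β u) (point ∘ ι) (inject≤-injective d≤n d≤n _ _ ∘ point-injective)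

  base : ∀ i j → eval (β (ι i)) (point (ι j)) ≡ 0ℤ
  base i j with <-cmp i j
  ... | tri< i<j _ _ = gauge (∈-pairs i<j)
  -- On the diagonal the pairing is twice the value.
  ... | tri≈ _ refl _ = x+x≡0⇒x≡0 _ (vanish (ι i) (ι i))
  ... | tri> _ _ j<i = flip (ι j) (ι i) (gauge (∈-pairs j<i))

-- The coefficients of `β` are `n * d` unknowns. If the equations from `L` and the `triangle d`
-- extra ones were fewer, some nonzero `β` would satisfy them all, although `gauge-fixed⇒zero` makes
-- it zero.
spanning-bound : d + d < n → (L : List (Pair n)) →
  (∀ (β : Fin n → Fin d → ℤ) → (∀ {u v} → (u , v) ∈ L → pairing β u v ≡ 0ℤ) →
     ∀ u v → u ≢ v → pairing β u v ≡ 0ℤ) →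
  n * d ≤ length L + triangle d
spanning-bound {d} {n} 2d<n L spanning = ℕᵖ.≮⇒≥ λ few →
  let c , (q , cq≢0) , solves = nontrivial-solution equations {form} form-linear
                                  (subst (_< n * d) (sym length-equations) few)
      β = family c
      off-diagonal = spanning β λ uv∈L → solves (∈-++⁺ˡ (∈-map⁺ inj₁ uv∈L))
      all-zero = gauge-fixed⇒zero β d≤n (everywhere β off-diagonal)
                   λ ij∈ → solves (∈-++⁺ʳ (map inj₁ L) (∈-map⁺ inj₂ ij∈))
      u , k = remQuot {n} d q
  in cq≢0 (trans (cong c (sym (combine-remQuot {n} d q))) (all-zero u k))
  where
  d≤n : d ≤ n
  d≤n = ℕᵖ.≤-trans (ℕᵖ.m≤m+n d d) (ℕᵖ.<⇒≤ 2d<n)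

  family : (Fin (n * d) → ℤ) → Fin n → Fin d → ℤ
  family c u k = c (combine u k)

  equations : List (Pair n ⊎ Pair d)
  equations = map inj₁ L ++ map inj₂ (pairs d)

  length-equations : length equations ≡ length L + triangle d
  length-equations = trans (length-++ (map inj₁ L)) (cong₂ ℕ._+_ (length-map inj₁ L) (length-map inj₂ (pairs d)))

  form : Pair n ⊎ Pair d → (Fin (n * d) → ℤ) → ℤ
  form (inj₁ (u , v)) c = pairing (family c) u v
  form (inj₂ (i , j)) c = eval (family c (inject≤ i d≤n)) (point (inject≤ j d≤n))

  form-linear : ∀ a → Linear (form a)
  form-linear (inj₁ (u , v)) = linear-+ (eval-linear (λ k → linear-coordinate (combine u k)) (point v))
                                        (eval-linear (λ k → linear-coordinate (combine v k)) (point u))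
  form-linear (inj₂ (i , j)) = eval-linear (λ k → linear-coordinate (combine (inject≤ i d≤n) k)) (point (inject≤ j d≤n))

  everywhere : (β : Fin n → Fin d → ℤ) → (∀ u v → u ≢ v → pairing β u v ≡ 0ℤ) → ∀ u v → pairing β u v ≡ 0ℤ
  everywhere β off-diagonal u v with u Fin.≟ v
  ... | yes refl = pairing-diagonal β 2d<n off-diagonal u
  ... | no u≢v = off-diagonal u v u≢v

-- Edge lists and the edges of a copy of K_{t,t}

∈-edges : (G : Graph n) {u v : Fin n} → u Fin.< v → Adj G u v → (u , v) ∈ edges G
∈-edges G {u} {v} u<v uv =
  ∈-filter⁺ _ (∈-cartesianProduct⁺ (∈-allFin u) (∈-allFin v)) (u<v , uv)

edges-adj : (G : Graph n) {u v : Fin n} → (u , v) ∈ edges G → u Fin.< v × Adj G u v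
edges-adj {n} G uv∈ = proj₂ (∈-filter⁻ _ {xs = cartesianProduct (allFin n) (allFin n)} uv∈)

∈-missing : (G : Graph n) {u v : Fin n} → u Fin.< v → ¬ Adj G u v → (u , v) ∈ missing (complete n) G
∈-missing G u<v ¬uv = ∈-filter⁺ _ (∈-edges (complete _) u<v (λ { refl → ℕᵖ.n≮n _ u<v })) ¬uv

missing-nonadj : (F G : Graph n) {u v : Fin n} → (u , v) ∈ missing F G → Adj F u v × ¬ Adj G u v
missing-nonadj F G uv∈ with uv∈F , ¬uv ← ∈-filter⁻ _ {xs = edges F} uv∈ = proj₂ (edges-adj F uv∈F) , ¬uv

lookup-injective : Unique xs → ∀ i j → lookup xs i ≡ lookup xs j → i ≡ j
lookup-injective (_ ∷ _)      zero    zero    _  = refl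
lookup-injective (x∉xs ∷ _)   zero    (suc j) eq = contradiction eq (All.lookup x∉xs (∈-lookup j))
lookup-injective (x∉xs ∷ _)   (suc i) zero    eq = contradiction (sym eq) (All.lookup x∉xs (∈-lookup i))
lookup-injective (_ ∷ unique) (suc i) (suc j) eq = cong suc (lookup-injective unique i j eq)

unique-⊆⇒length-≤ : Unique xs → (∀ {x} → x ∈ xs → x ∈ ys) → length xs ≤ length ys
unique-⊆⇒length-≤ {xs = xs} unique xs⊆ys = injective⇒≤ {f = λ i → index (xs⊆ys (∈-lookup i))} λ {i} {j} eq →
  lookup-injective unique i j (index-injective (setoid _) (xs⊆ys (∈-lookup i)) (xs⊆ys (∈-lookup j)) eq)

∈-take⁻ : ∀ k (xs : List X) → x ∈ take k xs → ∃[ i ] (toℕ i < k × lookup xs i ≡ x)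
∈-take⁻ (suc k) (_ ∷ xs) (here refl) = zero , s≤s z≤n , refl
∈-take⁻ (suc k) (_ ∷ xs) (there x∈) with i , i<k , eq ← ∈-take⁻ k xs x∈ = suc i , s≤s i<k , eq

∈-take-suc⁻ : (xs : List X) (i : Fin (length xs)) → x ∈ take (suc (toℕ i)) xs →
              (∃[ j ] (j Fin.< i × lookup xs j ≡ x)) ⊎ x ≡ lookup xs i
∈-take-suc⁻ xs i x∈ with ∈-++⁻ (take (toℕ i) xs) (subst (_ ∈_) (take-suc xs i) x∈)
... | inj₁ x∈take    = inj₁ (∈-take⁻ (toℕ i) xs x∈take)
... | inj₂ (here eq) = inj₂ eq

lookup∈take-suc : (xs : List X) (i : Fin (length xs)) → lookup xs i ∈ take (suc (toℕ i)) xs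
lookup∈take-suc (x ∷ xs) zero    = here refl
lookup∈take-suc (x ∷ xs) (suc i) = there (lookup∈take-suc xs i)

module _ {G : Graph n} (c : Copy (completeBipartite t t) G) where
  open Copy c

  left right : Fin t → Fin n
  left i  = vertex (i ↑ˡ t)
  right j = vertex (t ↑ʳ j)

  left-injective : Injective _≡_ _≡_ left
  left-injective = ↑ˡ-injective t _ _ ∘ injective

  right-injective : Injective _≡_ _≡_ right
  right-injective = ↑ʳ-injective t _ _ ∘ injective

  left≢right : ∀ i j → left i ≢ right j
  left≢right i j = ↑ˡ≢↑ʳ i j ∘ injective

  opposite-sides : ∀ i j → Adj (completeBipartite t t) (i ↑ˡ t) (t ↑ʳ j)
  opposite-sides i j rewrite splitAt-↑ˡ t i t | splitAt-↑ʳ t t j = tt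

  left-right : ∀ i j → Adj G (left i) (right j)
  left-right i j = edge (opposite-sides i j)

  left-right∈ : ∀ i j → (left i , right j) ∈ᴱ c
  left-right∈ i j = i ↑ˡ t , t ↑ʳ j , opposite-sides i j , refl , refl

  ∈ᴱ-sym : ∀ {u v} → (u , v) ∈ᴱ c → (v , u) ∈ᴱ c
  ∈ᴱ-sym (a , b , ab , refl , refl) = b , a , adj-sym (completeBipartite t t) {a} {b} ab , refl , refl

  ∈ᴱ⇒sides : ∀ {u v} → (u , v) ∈ᴱ c →
    ∃[ i ] ∃[ j ] ((left i ≡ u × right j ≡ v) ⊎ (left i ≡ v × right j ≡ u))
  ∈ᴱ⇒sides (a , b , ab , refl , refl) with splitAt t a in a≡ | splitAt t b in b≡
  ... | inj₁ i | inj₂ j = i , j , inj₁ (cong vertex (splitAt⁻¹-↑ˡ a≡) , cong vertex (splitAt⁻¹-↑ʳ b≡))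
  ... | inj₂ j | inj₁ i = i , j , inj₂ (cong vertex (splitAt⁻¹-↑ˡ b≡) , cong vertex (splitAt⁻¹-↑ʳ a≡))

module _ {d n : ℕ} (β : Fin n → Fin d → ℤ) where

  Vanishes : Pair n → Set
  Vanishes (u , v) = pairing β u v ≡ 0ℤ

  vanishes-sym : ∀ {u v} → Vanishes (u , v) → Vanishes (v , u)
  vanishes-sym {u} {v} = trans (pairing-sym β v u)

  -- `exchange` on the two sides of the copy. Edges are unordered but pairs are ordered, so both
  -- orientations of `(u , v)` are exempt from the vanishing; the sides being disjoint, a pair from
  -- left to right can match only one of them.
  copy-exchange : {G : Graph n} (c : Copy (completeBipartite (suc d) (suc d)) G) → ∀ {u v} → (u , v) ∈ᴱ c →
    (∀ {u′ v′} → Adj G u′ v′ → (u′ , v′) ≢ (u , v) → (u′ , v′) ≢ (v , u) → Vanishes (u′ , v′)) →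
    Vanishes (u , v)
  copy-exchange c uv∈c vanish with ∈ᴱ⇒sides c uv∈c
  ... | i , j , inj₁ (refl , refl) = exchange β (left c) (right c) (left-injective c) (right-injective c) i j
    λ { i′ j′ ≢ij → vanish (left-right c i′ j′)
          (λ eq → [ (λ i′≢i → i′≢i (left-injective c (cong proj₁ eq)))
                  , (λ j′≢j → j′≢j (right-injective c (cong proj₂ eq))) ]′ ≢ij)
          (λ eq → left≢right c i′ j (cong proj₁ eq)) }
  ... | i , j , inj₂ (refl , refl) = vanishes-sym
    (exchange β (left c) (right c) (left-injective c) (right-injective c) i j
    λ { i′ j′ ≢ij → vanish (left-right c i′ j′)
          (λ eq → left≢right c i′ j (cong proj₁ eq))
          (λ eq → [ (λ i′≢i → i′≢i (left-injective c (cong proj₁ eq)))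
                  , (λ j′≢j → j′≢j (right-injective c (cong proj₂ eq))) ]′ ≢ij) })

-- The part of WeaklySaturated (complete n) (completeBipartite t t) G that does not mention freeness.
record Percolates {n} (t : ℕ) (G : Graph n) : Set where
  field
    order    : List (Pair n)
    ordering : order ↭ missing (complete n) G
    creates  : (i : Fin (length order)) →
               Σ[ c ∈ Copy (completeBipartite t t) (G ∪ take (suc (toℕ i)) order) ] lookup order i ∈ᴱ c

-- Consequences of percolation for the number of edges

module _ {G : Graph n} (percolates : Percolates (suc d) G) where
  open Percolates percolates

  module _ (β : Fin n → Fin d → ℤ) (on-G : ∀ {u v} → Adj G u v → Vanishes β (u , v)) where

    -- The copy created by the edge at position `i` has its other edges in `G` or earlier in
    -- `order`, so `copy-exchange` carries the vanishing along `order`.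
    vanishes-on-order : ∀ {e} → e ∈ order → Vanishes β e
    vanishes-on-order e∈ = subst (Vanishes β) (sym (lookup-index e∈)) (below _ (index e∈) ℕᵖ.≤-refl)
      where
      step : ∀ i → (∀ j → j Fin.< i → Vanishes β (lookup order j)) → Vanishes β (lookup order i)
      step i earlier with c , e∈c ← creates i = copy-exchange β c e∈c λ
        { (inj₁ uv) _ _ → on-G uv
        ; (inj₂ (_ , inj₁ uv∈)) ≢e _ → listed uv∈ ≢e
        ; (inj₂ (_ , inj₂ vu∈)) _ ≢ẽ → vanishes-sym β (listed vu∈ λ eq → ≢ẽ (cong (λ (a , b) → b , a) eq)) }
        where
        listed : ∀ {e} → e ∈ take (suc (toℕ i)) order → e ≢ lookup order i → Vanishes β e
        listed e∈ ≢e with ∈-take-suc⁻ order i e∈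
        ... | inj₁ (j , j<i , refl) = earlier j j<i
        ... | inj₂ eq               = contradiction eq ≢e

      -- Course-of-values induction on the position, with `k` as its bound.
      below : ∀ k i → toℕ i < k → Vanishes β (lookup order i)
      below (suc k) i (s≤s i≤k) = step i λ j j<i → below k j (ℕᵖ.<-≤-trans j<i i≤k)

    vanishes-everywhere : ∀ u v → u ≢ v → Vanishes β (u , v)
    vanishes-everywhere u v u≢v with adj? G u v | <-cmp u v
    ... | yes uv | _            = on-G uv
    ... | no ¬uv | tri< u<v _ _ = vanishes-on-order (∈-resp-↭ (↭-sym ordering) (∈-missing G u<v ¬uv))
    ... | no _   | tri≈ _ u≡v _ = contradiction u≡v u≢v
    ... | no ¬uv | tri> _ _ v<u = vanishes-sym β
      (vanishes-on-order (∈-resp-↭ (↭-sym ordering) (∈-missing G v<u (¬uv ∘ adj-sym G))))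

  edges-vanish⇒adj-vanish : (β : Fin n → Fin d → ℤ) → (∀ {u v} → (u , v) ∈ edges G → Vanishes β (u , v)) →
                            ∀ {u v} → Adj G u v → Vanishes β (u , v)
  edges-vanish⇒adj-vanish β on-edges {u} {v} uv with <-cmp u v
  ... | tri< u<v _ _ = on-edges (∈-edges G u<v uv)
  ... | tri≈ _ u≡v _ = contradiction uv (adj-irrefl G u≡v)
  ... | tri> _ _ v<u = vanishes-sym β (on-edges (∈-edges G v<u (adj-sym G uv)))

  percolates⇒size-≥ : d + d < n → n * d ≤ size G + triangle d
  percolates⇒size-≥ 2d<n = spanning-bound 2d<n (edges G) λ β on-edges →
    vanishes-everywhere β (edges-vanish⇒adj-vanish β on-edges)

  -- An edge `e` of a copy inside `G` is redundant: by `copy-exchange`, vanishing on the remaining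
  -- edges forces vanishing on `e`. So `spanning-bound` applies to the edge list without `e`, which
  -- is strictly shorter.
  copy-edge⇒size-> : d + d < n → (c : Copy (completeBipartite (suc d) (suc d)) G) →
                     ∀ {e} → e ∈ edges G → e ∈ᴱ c → n * d < size G + triangle d
  copy-edge⇒size-> 2d<n c {e} e∈ e∈c = ℕᵖ.≤-<-trans
    (spanning-bound 2d<n others λ β on-others →
      vanishes-everywhere β (edges-vanish⇒adj-vanish β (on-edges β on-others)))
    (ℕᵖ.+-monoˡ-< (triangle d) (filter-notAll ≢e? (edges G) (Any.map (λ e≡ ≢e → ≢e (sym e≡)) e∈)))
    where
    _≟ₑ_ = ≡-dec (Fin._≟_ {n}) (Fin._≟_ {n})
    ≢e? = λ e′ → ¬? (e′ ≟ₑ e)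
    others = filter ≢e? (edges G)

    module _ (β : Fin n → Fin d → ℤ) (on-others : ∀ {u v} → (u , v) ∈ others → Vanishes β (u , v)) where
      adj : ∀ {u v} → Adj G u v → (u , v) ≢ e → (v , u) ≢ e → Vanishes β (u , v)
      adj {u} {v} uv ≢e ≢ẽ with <-cmp u v
      ... | tri< u<v _ _ = on-others (∈-filter⁺ ≢e? (∈-edges G u<v uv) ≢e)
      ... | tri≈ _ u≡v _ = contradiction uv (adj-irrefl G u≡v)
      ... | tri> _ _ v<u = vanishes-sym β (on-others (∈-filter⁺ ≢e? (∈-edges G v<u (adj-sym G uv)) ≢ẽ))

      on-edges : ∀ {u v} → (u , v) ∈ edges G → Vanishes β (u , v)
      on-edges {u} {v} uv∈ with (u , v) ≟ₑ e
      ... | yes refl = copy-exchange β c e∈c λ uv ≢e ≢ẽ → adj uv ≢e λ eq → ≢ẽ (cong (λ (a , b) → b , a) eq)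
      ... | no ≢e    = on-others (∈-filter⁺ ≢e? uv∈ ≢e)

  -- Freeness by counting alone: a copy contains the edge between `left c zero` and `right c zero`,
  -- which `edges G` lists with its smaller end first, and this edge would make the size bound
  -- strict.
  small⇒free : d + d < n → size G + triangle d ≤ n * d → ¬ Copy (completeBipartite (suc d) (suc d)) G
  small⇒free 2d<n small c with <-cmp (left c zero) (right c zero)
  ... | tri< l<r _ _ = ℕᵖ.≤⇒≯ small
    (copy-edge⇒size-> 2d<n c (∈-edges G l<r (left-right c zero zero)) (left-right∈ c zero zero))
  ... | tri≈ _ l≡r _ = left≢right c zero zero l≡r
  ... | tri> _ _ r<l = ℕᵖ.≤⇒≯ small
    (copy-edge⇒size-> 2d<n c (∈-edges G r<l (adj-sym G (left-right c zero zero))) (∈ᴱ-sym c (left-right∈ c zero zero)))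

-- The construction

module _ (G : Graph n) (P Q : Fin t → Fin n) (P-inj : Injective _≡_ _≡_ P) (Q-inj : Injective _≡_ _≡_ Q)
         (PQ : ∀ i j → Adj G (P i) (Q j)) where

  biclique : Copy (completeBipartite t t) G
  biclique = record
    { vertex    = place ∘ splitAt t
    ; injective = λ {a} {b} eq → trans (sym (join-splitAt t t a))
        (trans (cong (join t t) (place-injective (splitAt t a) (splitAt t b) eq)) (join-splitAt t t b))
    ; edge      = λ {a} {b} → place-edge (splitAt t a) (splitAt t b)
    }
    where
    place : Fin t ⊎ Fin t → Fin n
    place = [ P , Q ]′

    place-edge : ∀ x y → Opposite x y → Adj G (place x) (place y)
    place-edge (inj₁ i) (inj₂ j) _ = PQ i j
    place-edge (inj₂ j) (inj₁ i) _ = adj-sym G (PQ i j)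

    place-injective : ∀ x y → place x ≡ place y → x ≡ y
    place-injective (inj₁ i) (inj₁ j) eq = cong inj₁ (P-inj eq)
    -- The sides are disjoint because a common vertex would be adjacent to itself.
    place-injective (inj₁ i) (inj₂ j) eq = contradiction (PQ i j) (adj-irrefl G eq)
    place-injective (inj₂ i) (inj₁ j) eq = contradiction (PQ j i) (adj-irrefl G (sym eq))
    place-injective (inj₂ i) (inj₂ j) eq = cong inj₂ (Q-inj eq)

  ∈-biclique : ∀ i j → (P i , Q j) ∈ᴱ biclique
  ∈-biclique i j = i ↑ˡ t , t ↑ʳ j , opposite-sides biclique i j
    , cong [ P , Q ]′ (splitAt-↑ˡ t i t) , cong [ P , Q ]′ (splitAt-↑ʳ t t j)

∷-injective : {u : Fin n} {p : Fin d → Fin n} → Injective _≡_ _≡_ p → (∀ i → p i ≢ u) →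
              Injective _≡_ _≡_ (u Vector.∷ p)
∷-injective p-inj u∉p {zero}  {zero}  _  = refl
∷-injective p-inj u∉p {zero}  {suc j} eq = contradiction (sym eq) (u∉p j)
∷-injective p-inj u∉p {suc i} {zero}  eq = contradiction eq (u∉p i)
∷-injective p-inj u∉p {suc i} {suc j} eq = cong suc (p-inj eq)

biclique-through : {G : Graph n} {u v : Fin n} (p q : Fin d → Fin n) →
  Injective _≡_ _≡_ p → (∀ i → p i ≢ u) → Injective _≡_ _≡_ q → (∀ j → q j ≢ v) →
  Adj G u v → (∀ j → Adj G u (q j)) → (∀ i → Adj G (p i) v) → (∀ i j → Adj G (p i) (q j)) →
  Σ[ c ∈ Copy (completeBipartite (suc d) (suc d)) G ] (u , v) ∈ᴱ c
biclique-through {G = G} {u} {v} p q p-inj u∉p q-inj v∉q uv uq pv pq =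
  biclique G P Q P-inj Q-inj PQ , ∈-biclique G P Q P-inj Q-inj PQ zero zero
  where
  P = u Vector.∷ p
  Q = v Vector.∷ q
  P-inj = λ {i} {j} → ∷-injective p-inj u∉p {i} {j}
  Q-inj = λ {i} {j} → ∷-injective q-inj v∉q {i} {j}
  PQ : ∀ i j → Adj G (P i) (Q j)
  PQ zero    zero    = uv
  PQ zero    (suc j) = uq j
  PQ (suc i) zero    = pv i
  PQ (suc i) (suc j) = pq i j

-- With the edges sorted by `phase`, this makes every missing edge of smaller phase present by the
-- time the edge at position `i` is added.
∈-take-sorted : {R : X → X → Set} → (∀ {x} → R x x) → AllPairs R xs → x ∈ xs →
                (i : Fin (length xs)) → ¬ R (lookup xs i) x → x ∈ take (suc (toℕ i)) xs
∈-take-sorted R-refl (_ ∷ _)      (here refl) i       ¬R = here refl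
∈-take-sorted R-refl (y≤ys ∷ _)   (there x∈)  zero    ¬R = contradiction (All.lookup y≤ys x∈) ¬R
∈-take-sorted R-refl (_ ∷ sorted) (there x∈)  (suc i) ¬R = there (∈-take-sorted R-refl sorted x∈ i ¬R)

data Kind : Set where
  hub core rest : Kind

link : Kind → Kind → Bool
link hub  hub  = false
link hub  _    = true
link core hub  = true
link core core = true
link core rest = false
link rest hub  = true
link rest _    = false

link-sym : ∀ x y → T (link x y) → T (link y x)
link-sym hub  core _ = tt
link-sym hub  rest _ = tt
link-sym core hub  _ = tt
link-sym core core _ = tt
link-sym rest hub  _ = tt

-- Chosen so that the levels of the ends of a missing edge add up to 1 for core and rest, 2 for rest
-- and rest, 4 for hub and hub, which is the order in which these edges are added.
level : Kind → ℕ
level core = 0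
level rest = 1
level hub  = 2

-- `r` is the number of vertices of kind `rest`. The inequality provides `d + d` vertices outside
-- the hubs, which fill up both sides of a copy through two hubs.
module Construction (d r : ℕ) (2d≤ : d + d ≤ suc d + r) where

  m n′ : ℕ
  m  = suc d + r
  n′ = d + m

  hubs : Fin d → Fin n′
  hubs i = i ↑ˡ m

  others : Fin m → Fin n′
  others x = d ↑ʳ x

  cores : Fin (suc d) → Fin n′
  cores j = others (j ↑ˡ r)

  kind : Fin n′ → Kind
  kind v = [ (λ _ → hub) , (λ x → [ (λ _ → core) , (λ _ → rest) ]′ (splitAt (suc d) x)) ]′ (splitAt d v)

  kind-hubs : ∀ i → kind (hubs i) ≡ hub
  kind-hubs i rewrite splitAt-↑ˡ d i m = refl

  kind-others : ∀ x → kind (others x) ≢ hub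
  kind-others x eq rewrite splitAt-↑ʳ d m x with splitAt (suc d) x | eq
  ... | inj₁ _ | ()
  ... | inj₂ _ | ()

  kind-cores : ∀ j → kind (cores j) ≡ core
  kind-cores j rewrite splitAt-↑ʳ d m (j ↑ˡ r) | splitAt-↑ˡ (suc d) j r = refl

  hubs-or-others : ∀ v → (∃[ i ] v ≡ hubs i) ⊎ (∃[ x ] v ≡ others x)
  hubs-or-others v with splitAt d v in eq
  ... | inj₁ i = inj₁ (i , sym (splitAt⁻¹-↑ˡ eq))
  ... | inj₂ x = inj₂ (x , sym (splitAt⁻¹-↑ʳ eq))

  core⇒cores : ∀ v → kind v ≡ core → ∃[ j ] v ≡ cores j
  core⇒cores v eq with splitAt d v in v≡
  ... | inj₂ x with splitAt (suc d) x in x≡ | eq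
  ...   | inj₁ j | _ = j , sym (trans (cong others (splitAt⁻¹-↑ˡ x≡)) (splitAt⁻¹-↑ʳ v≡))
  ...   | inj₂ _ | ()

  hubs-injective : Injective _≡_ _≡_ hubs
  hubs-injective = ↑ˡ-injective m _ _

  others-injective : Injective _≡_ _≡_ others
  others-injective = ↑ʳ-injective d _ _

  cores-injective : Injective _≡_ _≡_ cores
  cores-injective = ↑ˡ-injective r _ _ ∘ others-injective

  kinds-differ : ∀ {u v x y} → kind u ≡ x → kind v ≡ y → x ≢ y → u ≢ v
  kinds-differ refl refl x≢y refl = x≢y refl

  G : Graph n′
  G = record
    { Adj        = λ u v → u ≢ v × T (link (kind u) (kind v))
    ; adj?       = λ u v → ¬? (u Fin.≟ v) ×-dec T? (link (kind u) (kind v))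
    ; adj-sym    = λ {u} {v} (u≢v , l) → u≢v ∘ sym , link-sym (kind u) (kind v) l
    ; adj-irrefl = λ u≡v (u≢v , _) → u≢v u≡v
    }

  adjacent : ∀ {u v x y} → kind u ≡ x → kind v ≡ y → T (link x y) → u ≢ v → Adj G u v
  adjacent refl refl l u≢v = u≢v , l

  adjacent-hub : ∀ {u v} → kind u ≡ hub → kind v ≢ hub → Adj G u v
  adjacent-hub {u} {v} u-hub = helper (kind v) refl
    where
    helper : ∀ y → kind v ≡ y → y ≢ hub → Adj G u v
    helper hub  _      hub≢hub = contradiction refl hub≢hub
    helper core v-core _       = adjacent u-hub v-core tt (kinds-differ u-hub v-core λ ())
    helper rest v-rest _       = adjacent u-hub v-rest tt (kinds-differ u-hub v-rest λ ())

  phase : Pair n′ → ℕ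
  phase (u , v) = level (kind u) + level (kind v)

  -- `H` stands for the graph at the moment the edge `uv` is added: it contains `G`, `uv` and all
  -- pairs of smaller phase.
  module _ (H : Graph n′) (G⊆H : G ⊆ H) {u v : Fin n′} (uv : Adj H u v) (¬uv : ¬ Adj G u v)
           (earlier : ∀ {u′ v′} → u′ ≢ v′ → phase (u′ , v′) < phase (u , v) → Adj H u′ v′) where

    private
      through = biclique-through {d = d} {G = H} {u} {v}

      Through : Set
      Through = Σ[ c ∈ Copy (completeBipartite (suc d) (suc d)) H ] (u , v) ∈ᴱ c

      u≢v : u ≢ v
      u≢v u≡v = adj-irrefl H u≡v uv

      G-sym : ∀ {u v} → Adj G u v → Adj H v u
      G-sym = G⊆H ∘ adj-sym G

      ≢hub : ∀ {v x} → kind v ≡ x → x ≢ hub → kind v ≢ hub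
      ≢hub refl x≢hub = x≢hub

      hub~ : ∀ {v} i → kind v ≢ hub → Adj G (hubs i) v
      hub~ i = adjacent-hub (kind-hubs i)

      core≢hub : ∀ j → kind (cores j) ≢ hub
      core≢hub j = ≢hub (kind-cores j) λ ()

      core-core : ∀ {i j} → i ≢ j → Adj G (cores i) (cores j)
      core-core i≢j = adjacent (kind-cores _) (kind-cores _) tt (i≢j ∘ cores-injective)

      other-cores : ∀ j → Injective _≡_ _≡_ (cores ∘ punchIn j)
      other-cores j = punchIn-injective j _ _ ∘ cores-injective

    -- The sides are `u` with the hubs and `v` with the other `d` core vertices; all edges but `uv`
    -- lie in `G`.
    core-rest : kind u ≡ core → kind v ≡ rest → Through
    core-rest u-core v-rest with j , refl ← core⇒cores u u-core =
      through hubs (cores ∘ punchIn j)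
        hubs-injective (λ i → kinds-differ (kind-hubs i) u-core λ ())
        (other-cores j) (λ i → kinds-differ (kind-cores (punchIn j i)) v-rest λ ())
        uv
        (λ i → G⊆H (core-core (punchInᵢ≢i j i ∘ sym)))
        (λ i → G⊆H (hub~ i (≢hub v-rest λ ())))
        (λ i i′ → G⊆H (hub~ i (core≢hub (punchIn j i′))))

    rest-core : kind u ≡ rest → kind v ≡ core → Through
    rest-core u-rest v-core with j , refl ← core⇒cores v v-core =
      through (cores ∘ punchIn j) hubs
        (other-cores j) (λ i → kinds-differ (kind-cores (punchIn j i)) u-rest λ ())
        hubs-injective (λ i → kinds-differ (kind-hubs i) v-core λ ())
        uv
        (λ i → G-sym (hub~ i (≢hub u-rest λ ())))
        (λ i → G⊆H (core-core (punchInᵢ≢i j i)))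
        (λ i i′ → G-sym (hub~ i′ (core≢hub (punchIn j i))))

    -- The sides are `u` with `d` core vertices and `v` with the hubs. The edges between the core
    -- and `v` are not in `G`, but they have phase 1 and `uv` has phase 2.
    rest-rest : kind u ≡ rest → kind v ≡ rest → Through
    rest-rest u-rest v-rest =
      through (cores ∘ suc) hubs
        (Finᵖ.suc-injective ∘ cores-injective) (λ i → kinds-differ (kind-cores (suc i)) u-rest λ ())
        hubs-injective (λ i → kinds-differ (kind-hubs i) v-rest λ ())
        uv
        (λ i → G-sym (hub~ i (≢hub u-rest λ ())))
        (λ i → earlier (kinds-differ (kind-cores (suc i)) v-rest λ ())
          (subst₂ _<_ (sym (cong₂ ℕ._+_ (cong level (kind-cores (suc i))) (cong level v-rest)))
                      (sym (cong₂ ℕ._+_ (cong level u-rest) (cong level v-rest)))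
                      (s≤s (s≤s z≤n))))
        (λ i i′ → G-sym (hub~ i′ (core≢hub (suc i))))

    -- Both `u` and `v` are joined in `G` to all non-hubs, so each side takes `d` of these. Pairs of
    -- non-hubs have phase at most 2, below the phase 4 of `uv`.
    hub-hub : kind u ≡ hub → kind v ≡ hub → Through
    hub-hub u-hub v-hub =
      through p q
        (λ {i} {j} → ↑ˡ-injective d i j ∘ out-injective) (λ i → out≢hub (i ↑ˡ d) u-hub)
        (λ {i} {j} → ↑ʳ-injective d i j ∘ out-injective) (λ j → out≢hub (d ↑ʳ j) v-hub)
        uv
        (λ j → G⊆H (adjacent-hub u-hub (kind-others _)))
        (λ i → G-sym (adjacent-hub v-hub (kind-others _)))
        (λ i j → earlier (λ eq → ↑ˡ≢↑ʳ i j (out-injective eq))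
          (subst (phase (p i , q j) <_) (sym (cong₂ ℕ._+_ (cong level u-hub) (cong level v-hub)))
            (s≤s (ℕᵖ.≤-trans (ℕᵖ.+-mono-≤ (level-≤1 (kind-others _)) (level-≤1 (kind-others _))) (ℕᵖ.n≤1+n 2)))))
      where
      out : Fin (d + d) → Fin n′
      out x = others (inject≤ x 2d≤)

      p q : Fin d → Fin n′
      p i = out (i ↑ˡ d)
      q j = out (d ↑ʳ j)

      out-injective : ∀ {x y} → out x ≡ out y → x ≡ y
      out-injective = inject≤-injective 2d≤ 2d≤ _ _ ∘ others-injective

      out≢hub : ∀ x {w} → kind w ≡ hub → out x ≢ w
      out≢hub x w-hub refl = kind-others _ w-hub

      level-≤1 : ∀ {v} → kind v ≢ hub → level (kind v) ≤ 1
      level-≤1 {v} v≢hub with kind v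
      ... | hub  = contradiction refl v≢hub
      ... | core = z≤n
      ... | rest = s≤s z≤n

    new-copy : Through
    new-copy = by-kinds (kind u) (kind v) refl refl
      where
      -- In the five remaining combinations of kinds the pair is already an edge of `G`.
      old : ∀ {x y} → kind u ≡ x → kind v ≡ y → T (link x y) → Through
      old u-kind v-kind l = contradiction (adjacent u-kind v-kind l u≢v) ¬uv

      by-kinds : ∀ x y → kind u ≡ x → kind v ≡ y → Through
      by-kinds hub  hub  u-hub  v-hub  = hub-hub u-hub v-hub
      by-kinds core rest u-core v-rest = core-rest u-core v-rest
      by-kinds rest core u-rest v-core = rest-core u-rest v-core
      by-kinds rest rest u-rest v-rest = rest-rest u-rest v-rest
      by-kinds hub  core u-hub  v-core = old u-hub v-core tt
      by-kinds hub  rest u-hub  v-rest = old u-hub v-rest tt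
      by-kinds core hub  u-core v-hub  = old u-core v-hub tt
      by-kinds core core u-core v-core = old u-core v-core tt
      by-kinds rest hub  u-rest v-hub  = old u-rest v-hub tt

  phase-order : DecTotalOrder _ _ _
  phase-order = On.decTotalOrder ℕᵖ.≤-decTotalOrder phase

  open Sort phase-order using (sort; sort-↭; sort-↗)

  -- The missing edges are added by increasing phase. Ties may fall in any order, since `new-copy`
  -- relies on strictly smaller phases only.
  percolation : Percolates (suc d) G
  percolation = record
    { order    = order
    ; ordering = sort-↭ _
    ; creates  = creates
    }
    where
    order : List (Pair n′)
    order = sort (missing (complete n′) G)

    sorted : AllPairs (λ e e′ → phase e ≤ phase e′) order
    sorted = Sorted⇒AllPairs (DecTotalOrder.totalOrder phase-order) (sort-↗ (missing (complete n′) G))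

    creates : (i : Fin (length order)) →
      Σ[ c ∈ Copy (completeBipartite (suc d) (suc d)) (G ∪ take (suc (toℕ i)) order) ] lookup order i ∈ᴱ c
    creates i = new-copy H inj₁ (inj₂ (proj₁ fresh , inj₁ (lookup∈take-suc order i))) (proj₂ fresh) earlier
      where
      H = G ∪ take (suc (toℕ i)) order
      fresh = missing-nonadj (complete n′) G (∈-resp-↭ (sort-↭ _) (∈-lookup {xs = order} i))

      taken : ∀ {e} → e ∈ missing (complete n′) G → phase e < phase (lookup order i) →
              e ∈ take (suc (toℕ i)) order
      taken e∈ lt = ∈-take-sorted ℕᵖ.≤-refl sorted (∈-resp-↭ (↭-sym (sort-↭ _)) e∈) i (ℕᵖ.<⇒≱ lt)

      earlier : ∀ {u v} → u ≢ v → phase (u , v) < phase (lookup order i) → Adj H u v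
      earlier {u} {v} u≢v lt with adj? G u v | <-cmp u v
      ... | yes uv | _ = inj₁ uv
      ... | no ¬uv | tri< u<v _ _ = inj₂ (u≢v , inj₁ (taken (∈-missing G u<v ¬uv) lt))
      ... | no ¬uv | tri≈ _ u≡v _ = contradiction u≡v u≢v
      ... | no ¬uv | tri> _ _ v<u = inj₂ (u≢v , inj₂ (taken (∈-missing G v<u (¬uv ∘ adj-sym G))
        (subst (_< phase (lookup order i)) (ℕᵖ.+-comm (level (kind u)) (level (kind v))) lt)))

  -- Counting the edges of the construction

  edges-unique : Unique (edges G)
  edges-unique = Unique.filter⁺ _ (Unique.cartesianProduct⁺ (Unique.allFin⁺ n′) (Unique.allFin⁺ n′))

  hub-edge : Fin (d * m) → Pair n′
  hub-edge q = let i , x = remQuot m q in hubs i , others x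

  core-edge : Pair (suc d) → Pair n′
  core-edge (i , j) = cores i , cores j

  listing : List (Pair n′)
  listing = map hub-edge (allFin (d * m)) ++ map core-edge (pairs (suc d))

  edges⊆listing : ∀ {e} → e ∈ edges G → e ∈ listing
  edges⊆listing {u , v} e∈ with u<v , (_ , l) ← edges-adj G e∈ = locate (hubs-or-others u) (hubs-or-others v) u<v l
    where
    both-core : ∀ x y → others x Fin.< others y → T (link (kind (others x)) (kind (others y))) →
                (others x , others y) ∈ listing
    both-core x y x<y l with kind (others x) in x-kind | kind (others y) in y-kind
    ... | hub  | _    = contradiction x-kind (kind-others x)
    ... | core | hub  = contradiction y-kind (kind-others y)
    ... | rest | hub  = contradiction y-kind (kind-others y)
    ... | core | core with i , x≡ ← core⇒cores _ x-kind | j , y≡ ← core⇒cores _ y-kind =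
      subst (_∈ listing) (sym (cong₂ _,_ x≡ y≡))
        (∈-++⁺ʳ (map hub-edge (allFin (d * m))) (∈-map⁺ core-edge (∈-pairs i<j)))
      where
      position : ∀ j → toℕ (cores j) ≡ d + toℕ j
      position j = trans (toℕ-↑ʳ d (j ↑ˡ r)) (cong (d ℕ.+_) (toℕ-↑ˡ j r))

      i<j : i Fin.< j
      i<j = ℕᵖ.+-cancelˡ-< d _ _ (subst₂ _<_ (trans (cong toℕ x≡) (position i)) (trans (cong toℕ y≡) (position j)) x<y)

    locate : ∀ {u v} → (∃[ i ] u ≡ hubs i) ⊎ (∃[ x ] u ≡ others x) → (∃[ i ] v ≡ hubs i) ⊎ (∃[ x ] v ≡ others x) →
             u Fin.< v → T (link (kind u) (kind v)) → (u , v) ∈ listing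
    locate (inj₁ (i , refl)) (inj₂ (x , refl)) _ _ = ∈-++⁺ˡ
      (subst (λ (i , x) → (hubs i , others x) ∈ map hub-edge (allFin (d * m))) (remQuot-combine i x)
        (∈-map⁺ hub-edge (∈-allFin (combine i x))))
    locate (inj₁ (i , refl)) (inj₁ (j , refl)) _ l =
      contradiction (subst₂ (λ x y → T (link x y)) (kind-hubs i) (kind-hubs j) l) λ ()
    -- Hubs come before all other vertices, and edges are listed with the smaller end first.
    locate (inj₂ (x , refl)) (inj₁ (i , refl)) x<i _ = contradiction x<i (ℕᵖ.≤⇒≯
      (subst₂ _≤_ (sym (toℕ-↑ˡ i m)) (sym (toℕ-↑ʳ d x)) (ℕᵖ.≤-trans (ℕᵖ.<⇒≤ (toℕ<n i)) (ℕᵖ.m≤m+n d (toℕ x)))))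
    locate (inj₂ (x , refl)) (inj₂ (y , refl)) x<y l = both-core x y x<y l

  size-≤ : size G ≤ d * m + triangle (suc d)
  size-≤ = ℕᵖ.≤-trans (unique-⊆⇒length-≤ edges-unique edges⊆listing)
    (ℕᵖ.≤-reflexive (trans (length-++ (map hub-edge (allFin (d * m))))
      (cong₂ ℕ._+_ (trans (length-map hub-edge (allFin (d * m))) (length-tabulate {n = d * m} (λ i → i)))
                   (length-map core-edge (pairs (suc d))))))

-- The closed formula

triangle-double : ∀ d → triangle d + triangle d + d ≡ d * d
triangle-double zero    = refl
triangle-double (suc d) = begin
  triangle (suc d) + triangle (suc d) + suc d ≡⟨ cong (λ T → T + T + suc d) (triangle-suc d) ⟩
  (d + triangle d) + (d + triangle d) + suc d ≡⟨ regroup d (triangle d) ⟩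
  (triangle d + triangle d + d) + d + suc d   ≡⟨ cong (λ s → s + d + suc d) (triangle-double d) ⟩
  d * d + d + suc d                           ≡⟨ square d ⟩
  suc d * suc d                               ∎
  where
  open ≡-Reasoning
  regroup : ∀ d T → (d + T) + (d + T) + suc d ≡ (T + T + d) + d + suc d
  regroup = ℕSolver.solve-∀
  square : ∀ d → d * d + d + suc d ≡ suc d * suc d
  square = ℕSolver.solve-∀

-- With t = d + 1 both sides are n d - d (d - 1) / 2. For unnormalised rationals equality is cross
-- multiplication, which leaves the integer identity `doubled`.
wsat-formula : ∀ d n k → k + triangle d ≡ n * d →
  (+ k) / 1 ≡ ((+ suc d) / 1 -ℚ 1ℚ) *ℚ ((+ n) / 1 +ℚ 1ℚ -ℚ (+ suc d) / 2)
wsat-formula d n k k+T≡nd = ℚᵖ.toℚᵘ-injective (begin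
  toℚᵘ ((+ k) / 1)
    -- `mkℚᵘ` takes the denominator minus one, so 0 and 1 as second arguments mean denominators 1
    -- and 2.
    ≈⟨ ℚᵖ.toℚᵘ-fromℚᵘ (mkℚᵘ (+ k) 0) ⟩
  mkℚᵘ (+ k) 0
    ≈⟨ *≡* doubled ⟩
  (mkℚᵘ (+ suc d) 0 ℚᵘ.- 1ℚᵘ) ℚᵘ.* (mkℚᵘ (+ n) 0 ℚᵘ.+ 1ℚᵘ ℚᵘ.- mkℚᵘ (+ suc d) 1)
    ≈⟨ ℚᵘᵖ.*-cong
         (ℚᵘᵖ.+-cong (ℚᵘᵖ.≃-sym (ℚᵖ.toℚᵘ-fromℚᵘ (mkℚᵘ (+ suc d) 0))) ℚᵘᵖ.≃-refl)
         (ℚᵘᵖ.+-cong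
           (ℚᵘᵖ.+-cong (ℚᵘᵖ.≃-sym (ℚᵖ.toℚᵘ-fromℚᵘ (mkℚᵘ (+ n) 0))) ℚᵘᵖ.≃-refl)
           (ℚᵘᵖ.-‿cong (ℚᵘᵖ.≃-sym (ℚᵖ.toℚᵘ-fromℚᵘ (mkℚᵘ (+ suc d) 1))))) ⟩
  (toℚᵘ [t] ℚᵘ.- 1ℚᵘ) ℚᵘ.* (toℚᵘ [n] ℚᵘ.+ 1ℚᵘ ℚᵘ.- toℚᵘ [t/2])
    ≈⟨ ℚᵘᵖ.≃-sym (ℚᵘᵖ.≃-trans (ℚᵖ.toℚᵘ-homo-* ([t] -ℚ 1ℚ) ([n] +ℚ 1ℚ -ℚ [t/2])) (ℚᵘᵖ.*-cong
         (homo-- [t] 1ℚ)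
         (ℚᵘᵖ.≃-trans (homo-- ([n] +ℚ 1ℚ) [t/2]) (ℚᵘᵖ.+-cong (ℚᵖ.toℚᵘ-homo-+ [n] 1ℚ) ℚᵘᵖ.≃-refl)))) ⟩
  toℚᵘ (([t] -ℚ 1ℚ) *ℚ ([n] +ℚ 1ℚ -ℚ [t/2])) ∎)
  where
  open ℚᵘᵖ.≃-Reasoning
  [t] = (+ suc d) / 1
  [n] = (+ n) / 1
  [t/2] = (+ suc d) / 2

  homo-- : ∀ p q → toℚᵘ (p -ℚ q) ℚᵘ.≃ toℚᵘ p ℚᵘ.- toℚᵘ q
  homo-- p q = ℚᵘᵖ.≃-trans (ℚᵖ.toℚᵘ-homo-+ p (-ℚ q)) (ℚᵘᵖ.+-cong (ℚᵘᵖ.≃-refl {toℚᵘ p}) (ℚᵖ.toℚᵘ-homo‿- q))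

  lift-sum : + k ℤ.+ + triangle d ≡ + n ℤ.* + d
  lift-sum = trans (cong +_ k+T≡nd) (ℤᵖ.pos-* n d)

  lift-double : + triangle d ℤ.+ + triangle d ℤ.+ + d ≡ + d ℤ.* + d
  lift-double = trans (cong +_ (triangle-double d)) (ℤᵖ.pos-* d d)

  -- Arranged so that `lift-sum` and `lift-double` can replace the two groups that contain `T`.
  eliminate-triangle : ∀ K T D → K ℤ.* + 2 ≡ (K ℤ.+ T) ℤ.* + 2 ℤ.- (T ℤ.+ T ℤ.+ D) ℤ.+ D
  eliminate-triangle = ℤSolver.solve-∀

  factor : ∀ N D → ((N ℤ.* D) ℤ.* + 2 ℤ.- D ℤ.* D ℤ.+ D) ≡
    (((+ 1 ℤ.+ D) ℤ.* + 1 ℤ.+ ℤ.- (+ 1) ℤ.* + 1) ℤ.*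
      ((N ℤ.* + 1 ℤ.+ + 1 ℤ.* + 1) ℤ.* + 2 ℤ.+ ℤ.- (+ 1 ℤ.+ D) ℤ.* + 1)) ℤ.* + 1
  factor = ℤSolver.solve-∀

  doubled : + k ℤ.* + 2 ≡
    (((+ 1 ℤ.+ + d) ℤ.* + 1 ℤ.+ ℤ.- (+ 1) ℤ.* + 1) ℤ.*
      ((+ n ℤ.* + 1 ℤ.+ + 1 ℤ.* + 1) ℤ.* + 2 ℤ.+ ℤ.- (+ 1 ℤ.+ + d) ℤ.* + 1)) ℤ.* + 1
  doubled = trans (eliminate-triangle (+ k) (+ triangle d) (+ d))
    (trans (cong₂ (λ x y → x ℤ.* + 2 ℤ.- y ℤ.+ + d) lift-sum lift-double) (factor (+ n) (+ d)))

-- Optimality of the construction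

module _ (d r : ℕ) (2d≤ : d + d ≤ suc d + r) where
  open Construction d r 2d≤

  private
    2d<n : d + d < d + (suc d + r)
    2d<n = ℕᵖ.+-monoʳ-< d (ℕᵖ.m≤m+n (suc d) r)

  -- The listing bounds the size from above and percolation bounds it from below, and the two bounds
  -- agree.
  construction-size : size G + triangle d ≡ (d + (suc d + r)) * d
  construction-size = ℕᵖ.≤-antisym
    (ℕᵖ.≤-trans (ℕᵖ.+-monoˡ-≤ (triangle d) size-≤) (ℕᵖ.≤-reflexive (count (suc d + r))))
    (percolates⇒size-≥ percolation 2d<n)
    where
    open ≡-Reasoning

    regroup : ∀ d M T → d * M + (d + T) + T ≡ d * M + (T + T + d)
    regroup = ℕSolver.solve-∀

    square : ∀ d M → d * M + d * d ≡ (d + M) * d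
    square = ℕSolver.solve-∀

    count : ∀ M → d * M + triangle (suc d) + triangle d ≡ (d + M) * d
    count M = begin
      d * M + triangle (suc d) + triangle d ≡⟨ cong (λ T → d * M + T + triangle d) (triangle-suc d) ⟩
      d * M + (d + triangle d) + triangle d ≡⟨ regroup d M (triangle d) ⟩
      d * M + (triangle d + triangle d + d) ≡⟨ cong (d * M ℕ.+_) (triangle-double d) ⟩
      d * M + d * d                         ≡⟨ square d M ⟩
      (d + M) * d                           ∎

  wsat-construction : IsWsat (complete (d + (suc d + r))) (completeBipartite (suc d) (suc d)) (size G)
  wsat-construction = record
    { attained = G , saturated , refl
    ; minimal  = λ G′ ws → ℕᵖ.+-cancelʳ-≤ (triangle d) _ _
        (ℕᵖ.≤-trans (ℕᵖ.≤-reflexive construction-size) (percolates⇒size-≥ (percolates G′ ws) 2d<n))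
    }
    where
    percolates : ∀ G′ → WeaklySaturated _ _ G′ → Percolates (suc d) G′
    percolates G′ ws = record { WeaklySaturated ws }

    saturated : WeaklySaturated (complete (d + (suc d + r))) (completeBipartite (suc d) (suc d)) G
    saturated = record
      { spanning = proj₁
      ; free     = small⇒free percolation 2d<n (ℕᵖ.≤-reflexive construction-size)
      ; Percolates percolation
      }

theorem2 : ∀ (t n : ℕ) → 2 ≤ t → 3 * t ∸ 3 ≤ n →
    ∃[ k ] (IsWsat (complete n) (completeBipartite t t) k ×
    (+ k) / 1 ≡ ((+ t) / 1 -ℚ 1ℚ) *ℚ ((+ n) / 1 +ℚ 1ℚ -ℚ (+ t) / 2))
theorem2 (suc d) n (s≤s 1≤d) 3t∸3≤n = subst
  (λ n → ∃[ k ] (IsWsat (complete n) (completeBipartite (suc d) (suc d)) k ×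
    (+ k) / 1 ≡ ((+ suc d) / 1 -ℚ 1ℚ) *ℚ ((+ n) / 1 +ℚ 1ℚ -ℚ (+ suc d) / 2)))
  n≡
  (_ , wsat-construction d r 2d≤ , wsat-formula d (d + (suc d + r)) _ (construction-size d r 2d≤))
  where
  3d≤n : d + (d + d) ≤ n
  3d≤n = subst (_≤ n) (trans (cong (_∸ 3) (ℕᵖ.*-suc 3 d)) (triple d)) 3t∸3≤n
    where
    triple : ∀ d → 3 * d ≡ d + (d + d)
    triple = ℕSolver.solve-∀

  -- What remains after `d` hubs and `suc d` core vertices.
  r : ℕ
  r = n ∸ (d + suc d)

  n≡ : d + (suc d + r) ≡ n
  n≡ = trans (sym (ℕᵖ.+-assoc d (suc d) r))
    -- The subtraction in `r` is exact, since `1≤d` gives d + (1 + d) ≤ 3 d ≤ n.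
    (ℕᵖ.m+[n∸m]≡n (ℕᵖ.≤-trans (ℕᵖ.+-monoʳ-≤ d (ℕᵖ.+-monoˡ-≤ d 1≤d)) 3d≤n))

  2d≤ : d + d ≤ suc d + r
  2d≤ = ℕᵖ.+-cancelˡ-≤ d _ _ (subst (d + (d + d) ≤_) (sym n≡) 3d≤n)
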